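{- Let $G_{L,3}(q)$ be as in the context, and write $S(q)\succeq 0$ to mean all coefficients of the power series $S(q)$ are nonnegative. Then: For $L \ge 10$: $G_{L,3}(q)+q^4+q^5+q^8+q^{10}+q^{12}+q^{14}+q^{16} \succeq 0$. $G_{9,3}(q)+q^4+q^5+q^8+q^{10}+q^{12}+q^{14}+2q^{16} \succeq 0$. $G_{8,3}(q)+q^4+q^5+q^8+q^{10}+q^{12}+q^{14}+2q^{16}+q^{20} \succeq 0$. $G_{7,3}(q)+q^4+q^5+q^8+q^{10}+q^{12}+2q^{14}+q^{16}+q^{20} \succeq 0$. $G_{6,3}(q)+q^4+q^5+q^8+q^{10}+q^{12}+q^{13}+2q^{14}+2q^{16}+q^{18}+2q^{20}+q^{22} \succeq 0$. $G_{5,3}(q)+q^4+q^5+q^8+q^{10}+2q^{12}+q^{13}+q^{14}+2q^{16}+q^{17}+q^{18}+3q^{20}+q^{22}+q^{24}+q^{28} \succeq 0$. $G_{4,3}(q)+q^4+q^5+q^8+q^{10}+q^{11}+2q^{12}+2q^{14}+3q^{16}+q^{17}+2q^{18}+q^{19}+4q^{20}+3q^{22}+q^{23}+4q^{24}+q^{25}+4q^{26}+5q^{28}+q^{29}+3q^{30}+6q^{32}+3q^{34}+4q^{36}+2q^{38}+4q^{40}+2q^{44} \succeq 0$.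
   Context: A partition $\pi$ is a finite weakly decreasing sequence of positive integers; $|\pi|$ is the sum of its parts, $s(\pi)$ its smallest part and $l(\pi)$ its largest part. For positive integers $L,s$, $$G_{L,s}(q) := \sum_{\substack{\pi \text{ nonempty},\ s(\pi)=s,\\ l(\pi)-s(\pi)\le L}} q^{|\pi|} \;-\; \sum_{\substack{\pi \text{ nonempty},\ s(\pi)\ge s+1,\\ l(\pi)-s(\pi)\le L}} q^{|\pi|}.$$ -}

module Defs where

open import Data.Bool using (Bool; true; false; _∧_; if_then_else_)
open import Data.Nat using (ℕ; zero; suc; _+_; _*_; _∸_; _⊓_; _⊔_; _≤ᵇ_; _≡ᵇ_)
open import Data.List using (List; []; _∷_; _++_; map; concatMap; replicate; length; filterᵇ; foldr; upTo)
open import Data.Nat.ListAction using (sum)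
open import Data.Product using (_×_; _,_)
open import Data.Integer using (ℤ; _-_) renaming (+_ to ⁺)

-- A partition is a weakly decreasing list of positive integers.
-- boundedPartitions h n : list of ALL partitions of n whose parts are all ≤ h,
-- each listed exactly once (as a weakly decreasing list).  Built by choosing
-- the multiplicity k of the part (suc h) and recursing on smaller parts.
boundedPartitions : ℕ → ℕ → List (List ℕ)
boundedPartitions zero zero = [] ∷ []
boundedPartitions zero (suc n) = []
boundedPartitions (suc h) n =
  concatMap
    (λ k → if k * suc h ≤ᵇ n
             then map (replicate k (suc h) ++_) (boundedPartitions h (n ∸ k * suc h))
             else [])
    (upTo (suc n))

partitions : ℕ → List (List ℕ)
partitions n = boundedPartitions n n

nonempty : List ℕ → Bool
nonempty [] = false
nonempty (_ ∷ _) = true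

smallest : List ℕ → ℕ
smallest [] = 0
smallest (x ∷ xs) = foldr _⊓_ x xs

largest : List ℕ → ℕ
largest [] = 0
largest (x ∷ xs) = foldr _⊔_ x xs

count : {A : Set} → (A → Bool) → List A → ℕ
count p xs = length (filterᵇ p xs)

countA : ℕ → ℕ → ℕ → ℕ
countA L s n = count (λ π → nonempty π ∧ (smallest π ≡ᵇ s) ∧ (largest π ∸ smallest π ≤ᵇ L)) (partitions n)

countB : ℕ → ℕ → ℕ → ℕ
countB L s n = count (λ π → nonempty π ∧ (suc s ≤ᵇ smallest π) ∧ (largest π ∸ smallest π ≤ᵇ L)) (partitions n)

-- coefficient of q^n in G_{L,s}(q)
G : ℕ → ℕ → ℕ → ℤ
G L s n = ⁺ (countA L s n) - ⁺ (countB L s n)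

coeff : List (ℕ × ℕ) → ℕ → ℕ
coeff p n = sum (map (λ { (e , c) → if e ≡ᵇ n then c else 0 }) p)

GPlusNonneg : ℕ → ℕ → List (ℕ × ℕ) → Set
GPlusNonneg L s p = (n : ℕ) → ⁺ 0 Data.Integer.≤ G L s n Data.Integer.+ ⁺ (coeff p n)

{-# OPTIONS --safe #-}
module Submission where

-- Write N(a, b) for the product of 1/(1 - q^i) over a ≤ i ≤ b.  Telescoping over the smallest part
-- gives G_{L,3} = q³ N(3, L+3) - (N(4, L+3) - 1)/(1 - q^L), so that
-- (1 - q^L) G_{L,3} = (2q³ - 1 - q^{L+3}) N(3, L+3) + 1.
-- If the coefficients of f are nonnegative from some degree on, then so are those of f/(1 - q^a) as
-- soon as a consecutive ones are; dividing successively by the factors of the denominator therefore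
-- settles each fixed L by computing finitely many coefficients.  To get started, note that
-- (2q³ - 1 - q^{L+3})(1 - q^60) remains a polynomial after division by 1 - q³ and 1 - q⁴, and that
-- the coefficients of its quotient by 1 - q⁵ are eventually nonnegative; 60 = lcm(3, 4, 5).
-- For L ≥ 18, the subtracted series (N(4, L+3) - 1)/(1 - q^L) is at most (N(4, L+3) - 1)/(1 - q^14),
-- because the coefficients of N(4, L+3) - 1 do not decrease under shifts by 4 or more.  What remains
-- is (2q³ - 1 - q^17) N(3, L+3)/(1 - q^14), where the parts above 17 are added one at a time and the
-- total damage they can do to each coefficient is bounded in advance.

open import Defs
open import Data.Bool using (Bool; true; false; _∧_; if_then_else_; T)
open import Data.Bool.ListAction using (all)
open import Data.Bool.Properties using (T-≡; T-∧; ∧-zeroʳ; ∧-identityʳ)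
open import Data.Empty using (⊥-elim)
open import Data.Fin using (zero; suc; toℕ)
import Data.Fin.Properties as Fin
open import Data.Integer using (ℤ; 0ℤ; _+_; _-_; -[1+_]; +≤+) renaming (+_ to ⁺; _≤_ to _≤ℤ_)
open import Data.Integer.Properties
open import Data.Integer.Tactic.RingSolver using (solve-∀)
open import Data.List using (List; []; _∷_; _++_; map; concatMap; replicate; applyUpTo)
open import Data.Nat as ℕ using (ℕ; zero; suc; _≤_; _<_; z≤n; s≤s; _≤ᵇ_; _<ᵇ_; _≡ᵇ_; _∸_; _⊓_; _⊔_)
open import Data.Nat.Induction using (<-rec)
import Data.Nat.Properties as ℕ
open import Data.Product using (_×_; _,_; proj₁; proj₂; ∃)
open import Data.Sum using (_⊎_; inj₁; inj₂)
open import Data.Unit using (tt)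
open import Data.Vec as Vec using (Vec; []; _∷_; _∷ʳ_; lookup; tabulate; zipWith)
open import Data.Vec.Properties using (lookup∘tabulate; lookup-zipWith; lookup-replicate)
open import Function using (_∘_)
open import Function.Bundles using (Equivalence)
open import Relation.Nullary using (yes; no; contradiction)
open import Relation.Binary.PropositionalEquality
import Algebra.Properties.CommutativeSemigroup as CommutativeSemigroupProperties

-- Power series, shifts and division by 1 - q^a.

Series : Set
Series = ℕ → ℤ

-- f n is the coefficient of q^n, and sh a f is q^a f.
sh : ℕ → Series → Series
sh zero f n = f n
sh (suc a) f zero = 0ℤ
sh (suc a) f (suc n) = sh a f n

δ : Series
δ zero = ⁺ 1
δ (suc n) = 0ℤ

sh-cong≤ : ∀ a {f g} n → (∀ m → m ≤ n → f m ≡ g m) → sh a f n ≡ sh a g n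
sh-cong≤ zero n e = e n ℕ.≤-refl
sh-cong≤ (suc a) zero e = refl
sh-cong≤ (suc a) (suc n) e = sh-cong≤ a n (λ m m≤n → e m (ℕ.m≤n⇒m≤1+n m≤n))

sh-cong : ∀ a {f g} → f ≗ g → sh a f ≗ sh a g
sh-cong a e n = sh-cong≤ a n (λ m _ → e m)

sh-cong< : ∀ b {f g} n → (∀ m → m < n → f m ≡ g m) → sh (suc b) f n ≡ sh (suc b) g n
sh-cong< b zero e = refl
sh-cong< b (suc n) e = sh-cong≤ b n (λ m m≤n → e m (s≤s m≤n))

sh-sh : ∀ a b f → sh a (sh b f) ≗ sh (a ℕ.+ b) f
sh-sh zero b f n = refl
sh-sh (suc a) b f zero = refl
sh-sh (suc a) b f (suc n) = sh-sh a b f n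

sh-comm : ∀ a b f → sh a (sh b f) ≗ sh b (sh a f)
sh-comm a b f n = begin
  sh a (sh b f) n   ≡⟨ sh-sh a b f n ⟩
  sh (a ℕ.+ b) f n  ≡⟨ cong (λ c → sh c f n) (ℕ.+-comm a b) ⟩
  sh (b ℕ.+ a) f n  ≡⟨ sh-sh b a f n ⟨
  sh b (sh a f) n   ∎
  where open ≡-Reasoning

sh-+ : ∀ a f g n → sh a (λ m → f m + g m) n ≡ sh a f n + sh a g n
sh-+ zero f g n = refl
sh-+ (suc a) f g zero = refl
sh-+ (suc a) f g (suc n) = sh-+ a f g n

sh-- : ∀ a f g n → sh a (λ m → f m - g m) n ≡ sh a f n - sh a g n
sh-- zero f g n = refl
sh-- (suc a) f g zero = refl
sh-- (suc a) f g (suc n) = sh-- a f g n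

sh-0 : ∀ a n → sh a (λ _ → 0ℤ) n ≡ 0ℤ
sh-0 zero n = refl
sh-0 (suc a) zero = refl
sh-0 (suc a) (suc n) = sh-0 a n

sh-in : ∀ a f n → sh a f (a ℕ.+ n) ≡ f n
sh-in zero f n = refl
sh-in (suc a) f n = sh-in a f n

sh-out : ∀ a f n → n < a → sh a f n ≡ 0ℤ
sh-out (suc a) f zero _ = refl
sh-out (suc a) f (suc n) (s≤s lt) = sh-out a f n lt

-- g = f / (1 - q^a).
record Quot (a : ℕ) (f g : Series) : Set where
  constructor quot
  field step : ∀ n → g n ≡ f n + sh a g n
open Quot

-- A shift by b + 1 ≥ 1 makes coefficient n of the quotient depend only on its earlier coefficients,
-- so strong induction on the degree applies.
Quot-unique : ∀ b {f f′ g g′} → f ≗ f′ → Quot (suc b) f g → Quot (suc b) f′ g′ → g ≗ g′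
Quot-unique b {f} {f′} {g} {g′} e q q′ = <-rec _ λ n ih → begin
  g n                      ≡⟨ step q n ⟩
  f n + sh (suc b) g n     ≡⟨ cong₂ _+_ (e n) (sh-cong< b n (λ m lt → ih lt)) ⟩
  f′ n + sh (suc b) g′ n   ≡⟨ step q′ n ⟨
  g′ n                     ∎
  where open ≡-Reasoning

Quot-sh : ∀ a b {f g} → Quot a f g → Quot a (sh b f) (sh b g)
Quot-sh a b {f} {g} q = quot λ n → begin
  sh b g n                     ≡⟨ sh-cong b (step q) n ⟩
  sh b (λ m → f m + sh a g m) n  ≡⟨ sh-+ b f (sh a g) n ⟩
  sh b f n + sh b (sh a g) n   ≡⟨ cong (λ z → sh b f n + z) (sh-comm b a g n) ⟩
  sh b f n + sh a (sh b g) n   ∎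
  where open ≡-Reasoning

Quot-+ : ∀ a {f f′ g g′} → Quot a f g → Quot a f′ g′ → Quot a (λ n → f n + f′ n) (λ n → g n + g′ n)
Quot-+ a {f} {f′} {g} {g′} q q′ = quot λ n → begin
  g n + g′ n                               ≡⟨ cong₂ _+_ (step q n) (step q′ n) ⟩
  (f n + sh a g n) + (f′ n + sh a g′ n)    ≡⟨ solve-∀′ (f n) (sh a g n) (f′ n) (sh a g′ n) ⟩
  (f n + f′ n) + (sh a g n + sh a g′ n)    ≡⟨ cong (λ z → (f n + f′ n) + z) (sh-+ a g g′ n) ⟨
  (f n + f′ n) + sh a (λ m → g m + g′ m) n ∎
  where
  open ≡-Reasoning
  solve-∀′ : ∀ w x y z → (w + x) + (y + z) ≡ (w + y) + (x + z)
  solve-∀′ = solve-∀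

Quot-- : ∀ a {f f′ g g′} → Quot a f g → Quot a f′ g′ → Quot a (λ n → f n - f′ n) (λ n → g n - g′ n)
Quot-- a {f} {f′} {g} {g′} q q′ = quot λ n → begin
  g n - g′ n                               ≡⟨ cong₂ _-_ (step q n) (step q′ n) ⟩
  (f n + sh a g n) - (f′ n + sh a g′ n)    ≡⟨ solve-∀′ (f n) (sh a g n) (f′ n) (sh a g′ n) ⟩
  (f n - f′ n) + (sh a g n - sh a g′ n)    ≡⟨ cong (λ z → (f n - f′ n) + z) (sh-- a g g′ n) ⟨
  (f n - f′ n) + sh a (λ m → g m - g′ m) n ∎
  where
  open ≡-Reasoning
  solve-∀′ : ∀ w x y z → (w + x) - (y + z) ≡ (w - y) + (x - z)
  solve-∀′ = solve-∀

geomSum : ℕ → ℕ → Series → Series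
geomSum zero a f n = 0ℤ
geomSum (suc k) a f n = f n + sh a (geomSum k a f) n

-- For a ≥ 1 the terms q^(ia) f with i > n do not reach degree n, so n + 1 terms of the geometric
-- series already give coefficient n.
geom : ℕ → Series → Series
geom a f n = geomSum (suc n) a f n

geomSum-stable : ∀ b f {k k′} n → n < k → n < k′ → geomSum k (suc b) f n ≡ geomSum k′ (suc b) f n
geomSum-stable b f {suc k} {suc k′} n (s≤s p) (s≤s p′) =
  cong (λ z → f n + z) (sh-cong< b n λ m m<n →
    geomSum-stable b f m (ℕ.<-≤-trans m<n p) (ℕ.<-≤-trans m<n p′))

geom-Quot : ∀ b f → Quot (suc b) f (geom (suc b) f)
geom-Quot b f = quot λ n → cong (λ z → f n + z) (sh-cong< b n λ m m<n → geomSum-stable b f m m<n ℕ.≤-refl)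

geom-cong : ∀ b {f g} → f ≗ g → geom (suc b) f ≗ geom (suc b) g
geom-cong b {f} {g} e = Quot-unique b e (geom-Quot b f) (geom-Quot b g)

-- N lo k is the product of 1/(1 - q^i) over lo ≤ i < lo + k.
N : ℕ → ℕ → Series
N lo zero = δ
N lo (suc k) = geom (lo ℕ.+ k) (N lo k)

diff : ℕ → Series → Series
diff a f n = f n - sh a f n

Quot-diff : ∀ a f → Quot a (diff a f) f
Quot-diff a f = quot λ n → lem (f n) (sh a f n)
  where
  lem : ∀ x y → x ≡ (x - y) + y
  lem = solve-∀

diff-Quot : ∀ a {f g} → Quot a f g → diff a g ≗ f
diff-Quot a {f} {g} q n = trans (cong (λ z → z - sh a g n) (step q n)) (lem (f n) (sh a g n))
  where
  lem : ∀ x y → (x + y) - y ≡ x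
  lem = solve-∀

Quot-congˡ : ∀ {a f f′ g} → f ≗ f′ → Quot a f g → Quot a f′ g
Quot-congˡ {a} {g = g} e q = quot λ n → trans (step q n) (cong (λ z → z + sh a g n) (e n))

-- By uniqueness: (1 - q^a) g′ is the quotient by 1 - q^(b+1) of (1 - q^a) f′ = f, and so is g.
Quot-comm : ∀ a b {f f′ g g′} → Quot a f f′ → Quot (suc b) f g → Quot (suc b) f′ g′ → Quot a g g′
Quot-comm a b {f} {f′} {g} {g′} qf q q′ = Quot-congˡ
  (Quot-unique b (diff-Quot a qf) (Quot-- (suc b) q′ (Quot-sh (suc b) a q′)) q)
  (Quot-diff a g′)

-- `N` is built by adjoining the largest part. Commuting the divisions lets the smallest part be
-- adjoined last instead.
N-Quot-lowest : ∀ t k → Quot (suc t) (N (2 ℕ.+ t) k) (N (suc t) (suc k))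
N-Quot-lowest t zero rewrite ℕ.+-identityʳ t = geom-Quot t δ
N-Quot-lowest t (suc k) = Quot-comm (suc t) (suc (t ℕ.+ k)) (N-Quot-lowest t k)
  (geom-Quot (suc (t ℕ.+ k)) (N (2 ℕ.+ t) k))
  (subst (λ c → Quot (suc c) (N (suc t) (suc k)) (N (suc t) (2 ℕ.+ k))) (ℕ.+-suc t k) (geom-Quot (t ℕ.+ suc k) (N (suc t) (suc k))))

-- Counting partitions whose parts satisfy a predicate.

⟦_⟧ : Bool → ℕ
⟦ true ⟧ = 1
⟦ false ⟧ = 0

open CommutativeSemigroupProperties ℕ.+-commutativeSemigroup using (interchange)

module _ {A : Set} where

  count-∷ : (p : A → Bool) → ∀ x xs → count p (x ∷ xs) ≡ ⟦ p x ⟧ ℕ.+ count p xs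
  count-∷ p x xs with p x
  ... | true = refl
  ... | false = refl

  count-cong : (p q : A → Bool) → p ≗ q → ∀ xs → count p xs ≡ count q xs
  count-cong p q e [] = refl
  count-cong p q e (x ∷ xs) = begin
    count p (x ∷ xs)          ≡⟨ count-∷ p x xs ⟩
    ⟦ p x ⟧ ℕ.+ count p xs    ≡⟨ cong₂ (λ b c → ⟦ b ⟧ ℕ.+ c) (e x) (count-cong p q e xs) ⟩
    ⟦ q x ⟧ ℕ.+ count q xs    ≡⟨ count-∷ q x xs ⟨
    count q (x ∷ xs)          ∎
    where open ≡-Reasoning

  count-+ : (p q r : A → Bool) → (∀ x → ⟦ p x ⟧ ℕ.+ ⟦ q x ⟧ ≡ ⟦ r x ⟧) →
            ∀ xs → count p xs ℕ.+ count q xs ≡ count r xs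
  count-+ p q r e [] = refl
  count-+ p q r e (x ∷ xs)
    rewrite count-∷ p x xs | count-∷ q x xs | count-∷ r x xs | sym (e x) | sym (count-+ p q r e xs) =
    interchange ⟦ p x ⟧ (count p xs) ⟦ q x ⟧ (count q xs)

  count-++ : (p : A → Bool) → ∀ xs ys → count p (xs ++ ys) ≡ count p xs ℕ.+ count p ys
  count-++ p [] ys = refl
  count-++ p (x ∷ xs) ys
    rewrite count-∷ p x (xs ++ ys) | count-∷ p x xs | count-++ p xs ys = sym (ℕ.+-assoc ⟦ p x ⟧ _ _)

  count-false : ∀ xs → count {A} (λ _ → false) xs ≡ 0
  count-false [] = refl
  count-false (x ∷ xs) = count-false xs

count-map : {A B : Set} (p : A → Bool) (f : B → A) → ∀ xs → count p (map f xs) ≡ count (p ∘ f) xs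
count-map p f [] = refl
count-map p f (x ∷ xs) rewrite count-∷ p (f x) (map f xs) | count-∷ (p ∘ f) x xs | count-map p f xs = refl

all-replicate-false : ∀ (R : ℕ → Bool) x k π → R x ≡ false → all R (replicate (suc k) x ++ π) ≡ false
all-replicate-false R x k π e rewrite e = refl

all-replicate-true : ∀ (R : ℕ → Bool) x k π → R x ≡ true → all R (replicate k x ++ π) ≡ all R π
all-replicate-true R x zero π e = refl
all-replicate-true R x (suc k) π e rewrite e = all-replicate-true R x k π e

-- The product of 1/(1 - q^i) over the 1 ≤ i ≤ h allowed by R, in the order in which
-- `boundedPartitions` treats the parts.
parts : (ℕ → Bool) → ℕ → Series
parts R zero = δ
parts R (suc h) = if R (suc h) then geom (suc h) (parts R h) else parts R h

sh-∸ : ∀ a f n → sh a f n ≡ (if a ≤ᵇ n then f (n ∸ a) else 0ℤ)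
sh-∸ zero f n = refl
sh-∸ (suc a) f zero = refl
sh-∸ (suc zero) f (suc n) = refl
sh-∸ (suc (suc a)) f (suc n) = sh-∸ (suc a) f n

module _ (R : ℕ → Bool) where

  countAll : ℕ → Series
  countAll h n = ⁺ (count (all R) (boundedPartitions h n))

  module _ (h n : ℕ) where

    private
      f : ℕ → List (List ℕ)
      f k = if k ℕ.* suc h ≤ᵇ n
              then map (replicate k (suc h) ++_) (boundedPartitions h (n ∸ k ℕ.* suc h))
              else []

    count-multiplicity : R (suc h) ≡ true → ∀ k → ⁺ (count (all R) (f k)) ≡ sh (k ℕ.* suc h) (countAll h) n
    count-multiplicity e k rewrite sh-∸ (k ℕ.* suc h) (countAll h) n with k ℕ.* suc h ≤ᵇ n
    ... | false = refl
    ... | true = cong ⁺ (trans (count-map (all R) (replicate k (suc h) ++_) (boundedPartitions h (n ∸ k ℕ.* suc h)))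
                   (count-cong (all R ∘ (replicate k (suc h) ++_)) (all R)
                     (λ π → all-replicate-true R (suc h) k π e) (boundedPartitions h (n ∸ k ℕ.* suc h))))

    -- The multiplicities j, ..., j + k - 1 of the part h + 1 contribute one segment of the
    -- geometric series. The function g is general because unfolding `applyUpTo` replaces it by
    -- `g ∘ suc`.
    count-multiplicities : R (suc h) ≡ true → ∀ k j g → (∀ i → g i ≡ j ℕ.+ i) →
      ⁺ (count (all R) (concatMap f (applyUpTo g k))) ≡ sh (j ℕ.* suc h) (geomSum k (suc h) (countAll h)) n
    count-multiplicities e zero j g eq = sym (sh-0 (j ℕ.* suc h) n)
    count-multiplicities e (suc k) j g eq = begin
      ⁺ (count (all R) (concatMap f (applyUpTo g (suc k))))
        ≡⟨ cong ⁺ (count-++ (all R) (f (g 0)) _) ⟩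
      ⁺ (count (all R) (f (g 0)) ℕ.+ count (all R) (concatMap f (applyUpTo (g ∘ suc) k)))
        ≡⟨ cong₂ _+_ (trans (cong (λ i → ⁺ (count (all R) (f i))) (trans (eq 0) (ℕ.+-identityʳ j))) (count-multiplicity e j))
             (count-multiplicities e k (suc j) (g ∘ suc) (λ i → trans (eq (suc i)) (ℕ.+-suc j i))) ⟩
      sh a c n + sh (suc h ℕ.+ a) s n
        ≡⟨ cong (λ b → sh a c n + sh b s n) (ℕ.+-comm (suc h) a) ⟩
      sh a c n + sh (a ℕ.+ suc h) s n
        ≡⟨ cong (λ z → sh a c n + z) (sh-sh a (suc h) s n) ⟨
      sh a c n + sh a (sh (suc h) s) n
        ≡⟨ sh-+ a c (sh (suc h) s) n ⟨
      sh a (λ m → c m + sh (suc h) s m) n ∎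
      where
      open ≡-Reasoning
      a = j ℕ.* suc h
      c = countAll h
      s = geomSum k (suc h) c

    count-none : R (suc h) ≡ false → ∀ k j g → (∀ i → g i ≡ suc (j ℕ.+ i)) →
      count (all R) (concatMap f (applyUpTo g k)) ≡ 0
    count-none e zero j g eq = refl
    count-none e (suc k) j g eq = trans (count-++ (all R) (f (g 0)) _)
      (cong₂ ℕ._+_ (trans (cong (λ i → count (all R) (f i)) (eq 0)) (head (j ℕ.+ 0)))
        (count-none e k (suc j) (g ∘ suc) (λ i → trans (eq (suc i)) (cong suc (ℕ.+-suc j i)))))
      where
      head : ∀ i → count (all R) (f (suc i)) ≡ 0
      head i with suc i ℕ.* suc h ≤ᵇ n
      ... | false = refl
      ... | true = trans (count-map (all R) (replicate (suc i) (suc h) ++_) (boundedPartitions h (n ∸ suc i ℕ.* suc h)))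
                    (trans (count-cong (all R ∘ (replicate (suc i) (suc h) ++_)) (λ _ → false)
                      (λ π → all-replicate-false R (suc h) i π e) (boundedPartitions h (n ∸ suc i ℕ.* suc h)))
                      (count-false (boundedPartitions h (n ∸ suc i ℕ.* suc h))))

  countAll-parts : ∀ h n → countAll h n ≡ parts R h n
  countAll-parts zero zero = refl
  countAll-parts zero (suc n) = refl
  countAll-parts (suc h) n with R (suc h) in e
  ... | true = trans (count-multiplicities h n e (suc n) 0 (λ i → i) (λ i → refl)) (geom-cong h (countAll-parts h) n)
  -- A forbidden part can only have multiplicity 0, the head of the list of multiplicities.
  ... | false = trans (cong ⁺ (trans (count-++ (all R) (map ([] ++_) (boundedPartitions h n)) _)
      (trans (cong₂ ℕ._+_ (count-map (all R) ([] ++_) (boundedPartitions h n)) (count-none h n e n 0 suc (λ _ → refl)))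
        (ℕ.+-identityʳ _)))) (countAll-parts h n)

parts-none : ∀ R h → (∀ i → i ≤ h → R i ≡ false) → parts R h ≗ δ
parts-none R zero _ n = refl
parts-none R (suc h) e n rewrite e (suc h) ℕ.≤-refl = parts-none R h (λ i i≤h → e i (ℕ.m≤n⇒m≤1+n i≤h)) n

-- A part larger than n cannot affect coefficient n. This reconciles the bound n built into
-- `partitions n` with the fixed upper end of an interval.
parts-beyond : ∀ R h k n → n ≤ h → parts R (k ℕ.+ h) n ≡ parts R h n
parts-beyond R h zero n n≤h = refl
parts-beyond R h (suc k) n n≤h with R (suc (k ℕ.+ h))
... | false = parts-beyond R h k n n≤h
... | true = begin
  geom c f n          ≡⟨ step (geom-Quot _ f) n ⟩
  f n + sh c (geom c f) n  ≡⟨ cong (λ z → f n + z) (sh-out c (geom c f) n (s≤s (ℕ.≤-trans n≤h (ℕ.m≤n+m h k)))) ⟩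
  f n + 0ℤ            ≡⟨ +-identityʳ (f n) ⟩
  f n                 ≡⟨ parts-beyond R h k n n≤h ⟩
  parts R h n         ∎
  where
  open ≡-Reasoning
  c = suc (k ℕ.+ h)
  f = parts R (k ℕ.+ h)

-- Partitions with all parts in an interval.

≤⇒≤ᵇ≡true : ∀ {m n} → m ≤ n → (m ≤ᵇ n) ≡ true
≤⇒≤ᵇ≡true le = Equivalence.to T-≡ (ℕ.≤⇒≤ᵇ le)

>⇒≤ᵇ≡false : ∀ {m n} → n < m → (m ≤ᵇ n) ≡ false
>⇒≤ᵇ≡false {m} {n} lt with m ≤ᵇ n in e
... | false = refl
... | true = contradiction (ℕ.≤ᵇ⇒≤ m n (Equivalence.from T-≡ e)) (ℕ.<⇒≱ lt)

between : ℕ → ℕ → ℕ → Bool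
between lo hi x = (lo ≤ᵇ x) ∧ (x ≤ᵇ hi)

parts-above : ∀ lo hi k → parts (between lo hi) (k ℕ.+ hi) ≗ parts (between lo hi) hi
parts-above lo hi zero n = refl
parts-above lo hi (suc k) n
  rewrite >⇒≤ᵇ≡false {suc (k ℕ.+ hi)} {hi} (s≤s (ℕ.m≤n+m hi k)) | ∧-zeroʳ (lo ≤ᵇ suc (k ℕ.+ hi)) = parts-above lo hi k n

parts-between : ∀ l hi k → k ℕ.+ l ≤ hi → parts (between (suc l) hi) (k ℕ.+ l) ≗ N (suc l) k
parts-between l hi zero le = parts-none (between (suc l) hi) l
  (λ i i≤l → cong (_∧ (i ≤ᵇ hi)) (>⇒≤ᵇ≡false (s≤s i≤l)))
parts-between l hi (suc k) le n
  rewrite ≤⇒≤ᵇ≡true {suc l} {suc (k ℕ.+ l)} (s≤s (ℕ.m≤n+m l k)) | ≤⇒≤ᵇ≡true le = begin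
  geom (suc (k ℕ.+ l)) (parts (between (suc l) hi) (k ℕ.+ l)) n
    ≡⟨ geom-cong (k ℕ.+ l) (parts-between l hi k (ℕ.<⇒≤ le)) n ⟩
  geom (suc (k ℕ.+ l)) (N (suc l) k) n
    ≡⟨ cong (λ c → geom (suc c) (N (suc l) k) n) (ℕ.+-comm k l) ⟩
  geom (suc (l ℕ.+ k)) (N (suc l) k) n ∎
  where open ≡-Reasoning

count-between : ∀ l k n → ⁺ (count (all (between (suc l) (k ℕ.+ l))) (partitions n)) ≡ N (suc l) k n
count-between l k n = begin
  countAll R n n             ≡⟨ countAll-parts R n n ⟩
  -- The bounds n and k + l on the parts are compared through their sum: the parts added are too
  -- large for degree n on one side and rejected by `between` on the other.
  parts R n n                ≡⟨ parts-beyond R n (k ℕ.+ l) n ℕ.≤-refl ⟨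
  parts R ((k ℕ.+ l) ℕ.+ n) n  ≡⟨ cong (λ h → parts R h n) (ℕ.+-comm (k ℕ.+ l) n) ⟩
  parts R (n ℕ.+ (k ℕ.+ l)) n  ≡⟨ parts-above (suc l) (k ℕ.+ l) n n ⟩
  parts R (k ℕ.+ l) n        ≡⟨ parts-between l (k ℕ.+ l) k ℕ.≤-refl n ⟩
  N (suc l) k n              ∎
  where
  open ≡-Reasoning
  R = between (suc l) (k ℕ.+ l)

-- Written as `all` of a constant predicate so that `countAll-parts` evaluates its count.
isEmpty : List ℕ → Bool
isEmpty = all (λ _ → false)

count-isEmpty : ∀ n → ⁺ (count isEmpty (partitions n)) ≡ δ n
count-isEmpty n = trans (countAll-parts _ n n) (parts-none (λ _ → false) n (λ _ _ → refl) n)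

≡true-ext : ∀ {a b} → (T a → T b) → (T b → T a) → a ≡ b
≡true-ext {false} {false} f g = refl
≡true-ext {false} {true} f g = ⊥-elim (g _)
≡true-ext {true} {false} f g = ⊥-elim (f _)
≡true-ext {true} {true} f g = refl

≤ᵇ-⊓ : ∀ t a b → (t ≤ᵇ a ⊓ b) ≡ (t ≤ᵇ a) ∧ (t ≤ᵇ b)
≤ᵇ-⊓ t a b = ≡true-ext
  (λ p → let q = ℕ.≤ᵇ⇒≤ t (a ⊓ b) p in Equivalence.from T-∧
    (ℕ.≤⇒≤ᵇ (ℕ.≤-trans q (ℕ.m⊓n≤m a b)) , ℕ.≤⇒≤ᵇ (ℕ.≤-trans q (ℕ.m⊓n≤n a b))))
  (λ p → let (q , r) = Equivalence.to T-∧ p in ℕ.≤⇒≤ᵇ (ℕ.⊓-glb (ℕ.≤ᵇ⇒≤ t a q) (ℕ.≤ᵇ⇒≤ t b r)))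

⊔-≤ᵇ : ∀ t a b → (a ⊔ b ≤ᵇ t) ≡ (a ≤ᵇ t) ∧ (b ≤ᵇ t)
⊔-≤ᵇ t a b = ≡true-ext
  (λ p → let q = ℕ.≤ᵇ⇒≤ (a ⊔ b) t p in Equivalence.from T-∧
    (ℕ.≤⇒≤ᵇ (ℕ.≤-trans (ℕ.m≤m⊔n a b) q) , ℕ.≤⇒≤ᵇ (ℕ.≤-trans (ℕ.m≤n⊔m a b) q)))
  (λ p → let (q , r) = Equivalence.to T-∧ p in ℕ.≤⇒≤ᵇ (ℕ.⊔-lub (ℕ.≤ᵇ⇒≤ a t q) (ℕ.≤ᵇ⇒≤ b t r)))

∧-swap : ∀ a b c → a ∧ (b ∧ c) ≡ b ∧ (a ∧ c)
∧-swap false false c = refl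
∧-swap false true c = refl
∧-swap true b c = refl

all-≥ : ∀ t x xs → all (t ≤ᵇ_) (x ∷ xs) ≡ (t ≤ᵇ smallest (x ∷ xs))
all-≥ t x [] = ∧-identityʳ (t ≤ᵇ x)
all-≥ t x (y ∷ xs) = trans (∧-swap (t ≤ᵇ x) (t ≤ᵇ y) _)
  (trans (cong ((t ≤ᵇ y) ∧_) (all-≥ t x xs)) (sym (≤ᵇ-⊓ t y _)))

all-≤ : ∀ t x xs → all (_≤ᵇ t) (x ∷ xs) ≡ (largest (x ∷ xs) ≤ᵇ t)
all-≤ t x [] = ∧-identityʳ (x ≤ᵇ t)
all-≤ t x (y ∷ xs) = trans (∧-swap (x ≤ᵇ t) (y ≤ᵇ t) _)
  (trans (cong ((y ≤ᵇ t) ∧_) (all-≤ t x xs)) (sym (⊔-≤ᵇ t y _)))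

all-∧ : ∀ (p q : ℕ → Bool) xs → all (λ x → p x ∧ q x) xs ≡ all p xs ∧ all q xs
all-∧ p q [] = refl
all-∧ p q (x ∷ xs) rewrite all-∧ p q xs with p x | q x
... | false | _ = refl
... | true | true = refl
... | true | false = sym (∧-zeroʳ (all p xs))

inside : ℕ → ℕ → List ℕ → Bool
inside lo hi π = nonempty π ∧ (lo ≤ᵇ smallest π) ∧ (largest π ≤ᵇ hi)

-- The empty partition satisfies `all` vacuously without being `inside`; it becomes the -1 in N - 1.
inside-all : ∀ lo hi π → ⟦ inside lo hi π ⟧ ℕ.+ ⟦ isEmpty π ⟧ ≡ ⟦ all (between lo hi) π ⟧
inside-all lo hi [] = refl
inside-all lo hi π@(x ∷ xs) = trans (ℕ.+-identityʳ _) (cong ⟦_⟧ (sym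
  (trans (all-∧ (lo ≤ᵇ_) (_≤ᵇ hi) π) (cong₂ _∧_ (all-≥ lo x xs) (all-≤ hi x xs)))))

count-inside : ∀ l k n → ⁺ (count (inside (suc l) (k ℕ.+ l)) (partitions n)) ≡ N (suc l) k n - δ n
count-inside l k n = begin
  ⁺ c                        ≡⟨ lem (⁺ c) (⁺ e) ⟩
  (⁺ c + ⁺ e) - ⁺ e          ≡⟨⟩
  ⁺ (c ℕ.+ e) - ⁺ e
    ≡⟨ cong₂ _-_ (cong ⁺ (count-+ (inside (suc l) (k ℕ.+ l)) isEmpty (all (between (suc l) (k ℕ.+ l)))
         (inside-all (suc l) (k ℕ.+ l)) (partitions n))) (count-isEmpty n) ⟩
  ⁺ (count (all (between (suc l) (k ℕ.+ l))) (partitions n)) - δ n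
                             ≡⟨ cong (λ z → z - δ n) (count-between l k n) ⟩
  N (suc l) k n - δ n        ∎
  where
  open ≡-Reasoning
  c = count (inside (suc l) (k ℕ.+ l)) (partitions n)
  e = count isEmpty (partitions n)
  lem : ∀ x y → x ≡ (x + y) - y
  lem = solve-∀

-- Telescoping over the smallest part.

split-smallest : ∀ s t b → ⟦ (s ≡ᵇ t) ∧ b ⟧ ℕ.+ ⟦ (suc t ≤ᵇ s) ∧ b ⟧ ≡ ⟦ (t ≤ᵇ s) ∧ b ⟧
split-smallest zero zero b = ℕ.+-identityʳ _
split-smallest zero (suc t) b = refl
split-smallest (suc s) zero b = refl
split-smallest (suc s) (suc zero) b = split-smallest s zero b
split-smallest (suc s) (suc (suc t)) b = split-smallest s (suc t) b

∸-≤ᵇ : ∀ s t l L → (s ≡ᵇ t) ∧ (l ∸ s ≤ᵇ L) ≡ (s ≡ᵇ t) ∧ (l ≤ᵇ L ℕ.+ t)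
∸-≤ᵇ s t l L with s ≡ᵇ t in e
... | false = refl
... | true rewrite ℕ.≡ᵇ⇒≡ s t (Equivalence.from T-≡ e) = ≡true-ext
  (λ p → ℕ.≤⇒≤ᵇ (subst (l ≤_) (ℕ.+-comm t L) (ℕ.≤-trans (ℕ.m≤n+m∸n l t) (ℕ.+-monoʳ-≤ t (ℕ.≤ᵇ⇒≤ (l ∸ t) L p)))))
  (λ p → ℕ.≤⇒≤ᵇ (ℕ.m≤n+o⇒m∸n≤o l t (subst (l ≤_) (ℕ.+-comm L t) (ℕ.≤ᵇ⇒≤ l (L ℕ.+ t) p))))

module _ (L : ℕ) where

  lowest atLeast : ℕ → List ℕ → Bool
  lowest t π = nonempty π ∧ (smallest π ≡ᵇ t) ∧ (largest π ∸ smallest π ≤ᵇ L)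
  atLeast t π = nonempty π ∧ (t ≤ᵇ smallest π) ∧ (largest π ∸ smallest π ≤ᵇ L)

  lowest-inside : ∀ t π → ⟦ lowest t π ⟧ ℕ.+ ⟦ inside (suc t) (L ℕ.+ t) π ⟧ ≡ ⟦ inside t (L ℕ.+ t) π ⟧
  lowest-inside t [] = refl
  lowest-inside t π@(_ ∷ _) rewrite ∸-≤ᵇ (smallest π) t (largest π) L =
    split-smallest (smallest π) t (largest π ≤ᵇ L ℕ.+ t)

  lowest-atLeast : ∀ t π → ⟦ lowest t π ⟧ ℕ.+ ⟦ atLeast (suc t) π ⟧ ≡ ⟦ atLeast t π ⟧
  lowest-atLeast t [] = refl
  lowest-atLeast t π@(_ ∷ _) = split-smallest (smallest π) t (largest π ∸ smallest π ≤ᵇ L)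

  A B : ℕ → Series
  A t n = ⁺ (countA L t n)
  B t n = ⁺ (countB L t n)

  -- With t = l + 1, these partitions have their parts in [t, t + L] but not all in [t + 1, t + L].
  -- By `N-Quot-lowest` the two products differ by q^t N(t, t + L).
  A-N : ∀ l n → A (suc l) n ≡ sh (suc l) (N (suc l) (suc L)) n
  A-N l n = begin
    A (suc l) n                     ≡⟨ lem (A (suc l) n) (⁺ c) ⟩
    ⁺ (countA L (suc l) n ℕ.+ c) - ⁺ c
      ≡⟨ cong (λ m → ⁺ m - ⁺ c) (count-+ (lowest (suc l)) (inside (2 ℕ.+ l) (L ℕ.+ suc l)) (inside (suc l) (L ℕ.+ suc l))
           (lowest-inside (suc l)) (partitions n)) ⟩
    ⁺ (count (inside (suc l) (L ℕ.+ suc l)) (partitions n)) - ⁺ c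
      ≡⟨ cong₂ _-_
           (trans (cong (λ h → ⁺ (count (inside (suc l) h) (partitions n))) (ℕ.+-suc L l)) (count-inside l (suc L) n))
           (count-inside (suc l) L n) ⟩
    (N (suc l) (suc L) n - δ n) - (N (2 ℕ.+ l) L n - δ n)
      ≡⟨ cong (λ z → (z - δ n) - (N (2 ℕ.+ l) L n - δ n)) (step (N-Quot-lowest l L) n) ⟩
    ((N (2 ℕ.+ l) L n + x) - δ n) - (N (2 ℕ.+ l) L n - δ n)
      ≡⟨ lem′ (N (2 ℕ.+ l) L n) x (δ n) ⟩
    x ∎
    where
    open ≡-Reasoning
    c = count (inside (2 ℕ.+ l) (L ℕ.+ suc l)) (partitions n)
    x = sh (suc l) (N (suc l) (suc L)) n
    lem : ∀ x y → x ≡ (x + y) - y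
    lem = solve-∀
    lem′ : ∀ x y z → ((x + y) - z) - (x - z) ≡ y
    lem′ = solve-∀

  -- Only the empty partition of n can have all its parts above l ≥ n. It accounts for the whole
  -- count, and `atLeast` excludes it.
  B-zero : ∀ l n → n ≤ l → B l n ≡ 0ℤ
  B-zero l n n≤l = cong ⁺ (ℕ.n≤0⇒n≡0 (ℕ.+-cancelʳ-≤ e (countB L l n) 0 (begin
    countB L l n ℕ.+ e  ≤⟨ count-≤ (partitions n) ⟩
    count (all (suc l ≤ᵇ_)) (partitions n)  ≡⟨ +-injective (trans (countAll-parts (suc l ≤ᵇ_) n n)
        (trans (parts-none (suc l ≤ᵇ_) n (λ i i≤n → >⇒≤ᵇ≡false (s≤s (ℕ.≤-trans i≤n n≤l))) n) (sym (count-isEmpty n)))) ⟩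
    e ∎)))
    where
    open ℕ.≤-Reasoning
    e = count isEmpty (partitions n)
    le : ∀ π → ⟦ atLeast (suc l) π ⟧ ℕ.+ ⟦ isEmpty π ⟧ ≤ ⟦ all (suc l ≤ᵇ_) π ⟧
    le [] = ℕ.≤-refl
    le π@(x ∷ xs) rewrite all-≥ (suc l) x xs with suc l ≤ᵇ smallest π | largest π ∸ smallest π ≤ᵇ L
    ... | false | _ = z≤n
    ... | true | false = z≤n
    ... | true | true = s≤s z≤n
    count-≤ : ∀ xs → count (atLeast (suc l)) xs ℕ.+ count isEmpty xs ≤ count (all (suc l ≤ᵇ_)) xs
    count-≤ [] = z≤n
    count-≤ (x ∷ xs) rewrite count-∷ (atLeast (suc l)) x xs | count-∷ isEmpty x xs | count-∷ (all (suc l ≤ᵇ_)) x xs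
      | interchange ⟦ atLeast (suc l) x ⟧ (count (atLeast (suc l)) xs) ⟦ isEmpty x ⟧ (count isEmpty xs) = ℕ.+-mono-≤ (le x) (count-≤ xs)

  B-step : ∀ l n → B l n ≡ A (suc l) n + B (suc l) n
  B-step l n = cong ⁺ (sym (count-+ (lowest (suc l)) (atLeast (2 ℕ.+ l)) (atLeast (suc l)) (lowest-atLeast (suc l)) (partitions n)))

  N-small : ∀ l k n → n ≤ l → N (suc l) k n ≡ δ n
  N-small l zero n n≤l = refl
  N-small l (suc k) n n≤l = trans (step (geom-Quot (l ℕ.+ k) (N (suc l) k)) n)
    (trans (cong₂ _+_ (N-small l k n n≤l) (sh-out (suc l ℕ.+ k) _ n (s≤s (ℕ.≤-trans n≤l (ℕ.m≤m+n l k))))) (+-identityʳ (δ n)))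

  -- Induction on d raises the bound l until it reaches n, where both sides vanish. Applied with d =
  -- n, it gives the closed form (N(l + 1, l + L) - 1)/(1 - q^L).
  B-Quot′ : ∀ d l n → n ≤ d ℕ.+ l → B l n ≡ (N (suc l) L n - δ n) + sh L (B l) n
  B-Quot′ zero l n n≤l = begin
    B l n    ≡⟨ B-zero l n n≤l ⟩
    0ℤ       ≡⟨ lem (δ n) ⟩
    (δ n - δ n) + 0ℤ ≡⟨ cong₂ (λ x y → (x - δ n) + y) (sym (N-small l L n n≤l))
                (trans (sym (sh-0 L n)) (sh-cong≤ L n (λ m m≤n → sym (B-zero l m (ℕ.≤-trans m≤n n≤l))))) ⟩
    (N (suc l) L n - δ n) + sh L (B l) n ∎
    where
    open ≡-Reasoning
    lem : ∀ x → 0ℤ ≡ (x - x) + 0ℤ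
    lem = solve-∀
  B-Quot′ (suc d) l n n≤ = begin
    B l n                 ≡⟨ B-step l n ⟩
    A (suc l) n + B (suc l) n
      ≡⟨ cong₂ _+_ (A-N l n) (B-Quot′ d (suc l) n (subst (n ≤_) (sym (ℕ.+-suc d l)) n≤)) ⟩
    sh t X n + ((N (2 ℕ.+ l) L n - δ n) + sh L (B (suc l)) n)
      ≡⟨ lem₁ (sh t X n) (N (2 ℕ.+ l) L n) (δ n) (sh L (B (suc l)) n) ⟩
    -- X = N(t, t + L) is reassembled along its lowest part t and then taken apart along its highest
    -- part t + L. The remainder q^(t+L) X is q^L times the series `A t`, which completes q^L `B t`
    -- to q^L `B l`.
    ((N (2 ℕ.+ l) L n + sh t X n) - δ n) + sh L (B (suc l)) n
      ≡⟨ cong (λ x → (x - δ n) + sh L (B (suc l)) n) (step (N-Quot-lowest l L) n) ⟨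
    (X n - δ n) + sh L (B (suc l)) n
      ≡⟨ cong (λ x → (x - δ n) + sh L (B (suc l)) n) (step (geom-Quot (l ℕ.+ L) (N t L)) n) ⟩
    ((N t L n + sh (t ℕ.+ L) X n) - δ n) + sh L (B (suc l)) n
      ≡⟨ lem₂ (N t L n) (sh (t ℕ.+ L) X n) (δ n) (sh L (B (suc l)) n) ⟩
    (N t L n - δ n) + (sh (t ℕ.+ L) X n + sh L (B (suc l)) n)
      ≡⟨ cong (λ z → (N t L n - δ n) + (z + sh L (B (suc l)) n)) (trans (cong (λ c → sh c X n) (ℕ.+-comm t L)) (sym (sh-sh L t X n))) ⟩
    (N t L n - δ n) + (sh L (sh t X) n + sh L (B (suc l)) n)
      ≡⟨ cong (λ z → (N t L n - δ n) + z) (sh-+ L (sh t X) (B (suc l)) n) ⟨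
    (N t L n - δ n) + sh L (λ m → sh t X m + B (suc l) m) n
      ≡⟨ cong (λ z → (N t L n - δ n) + z) (sh-cong L (λ m → trans (cong (λ z → z + B (suc l) m) (sym (A-N l m))) (sym (B-step l m))) n) ⟩
    (N t L n - δ n) + sh L (B l) n ∎
    where
    open ≡-Reasoning
    t = suc l
    X = N t (suc L)
    lem₁ : ∀ a b c d → a + ((b - c) + d) ≡ ((b + a) - c) + d
    lem₁ = solve-∀
    lem₂ : ∀ a b c d → ((a + b) - c) + d ≡ (a - c) + (b + d)
    lem₂ = solve-∀

  B-Quot : ∀ l → Quot L (λ n → N (suc l) L n - δ n) (B l)
  B-Quot l = quot λ n → B-Quot′ n l n (ℕ.m≤m+n n l)

-- Computing initial coefficients of quotients.

record Table {m} (xs : Vec ℤ m) (f : Series) : Set where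
  constructor table
  field at : ∀ i → lookup xs i ≡ f (toℕ i)
open Table

tail-Table : ∀ {m x} {xs : Vec ℤ m} {f} → Table (x ∷ xs) f → Table xs (f ∘ suc)
tail-Table t = table (at t ∘ suc)

prefix : ∀ {m} → Series → Vec ℤ m
prefix f = tabulate (f ∘ toℕ)

prefix-Table : ∀ {m} f → Table (prefix {m} f) f
prefix-Table f = table (lookup∘tabulate (f ∘ toℕ))

zipWith-Table : ∀ {m} {xs ys : Vec ℤ m} {f g} → Table xs f → Table ys g →
                Table (zipWith _+_ xs ys) (λ n → f n + g n)
zipWith-Table {xs = xs} {ys} tx ty = table λ i → trans (lookup-zipWith _+_ i xs ys) (cong₂ _+_ (at tx i) (at ty i))

-- The first argument holds the last b + 1 coefficients of the quotient, oldest first.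
queue : ∀ {b m} → Vec ℤ (suc b) → Vec ℤ m → Vec ℤ m
enqueue : ∀ {b m} → ℤ → Vec ℤ b → Vec ℤ m → Vec ℤ (suc m)
queue q [] = []
queue (y ∷ q) (x ∷ xs) = enqueue (x + y) q xs
enqueue z q xs = z ∷ queue (q ∷ʳ z) xs

-- Division by 1 - q^(b+1); the initial zeros are the coefficients in negative degrees.
divide : ∀ {m} → ℕ → Vec ℤ m → Vec ℤ m
divide b = queue (Vec.replicate (suc b) 0ℤ)

∷ʳ-Table : ∀ {b} (q : Vec ℤ b) {z s} → Table q s → z ≡ s b → Table (q ∷ʳ z) s
∷ʳ-Table [] t e = table λ { zero → e }
∷ʳ-Table (x ∷ q) t e = table λ { zero → at t zero ; (suc i) → at (∷ʳ-Table q (tail-Table t) e) i }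

-- Here s is q^(b+1) g seen from the current degree, and the queue holds its first b + 1 values. The
-- last hypothesis says that each coefficient produced comes back b + 1 degrees later, so the
-- invariant survives a step.
queue-Table : ∀ {b m} (q : Vec ℤ (suc b)) (xs : Vec ℤ m) {f g s} → Table q s → Table xs f →
  (∀ n → g n ≡ f n + s n) → (∀ n → s (suc b ℕ.+ n) ≡ g n) → Table (queue q xs) g
queue-Table q [] tq tx eg es = table λ ()
queue-Table {b} (y ∷ q) (x ∷ xs) {f} {g} {s} tq tx eg es = table λ
  { zero → first
  ; (suc i) → at (queue-Table (q ∷ʳ (x + y)) xs
      (∷ʳ-Table q (tail-Table tq) (trans first (trans (sym (es 0)) (cong (s ∘ suc) (ℕ.+-identityʳ b)))))
      (tail-Table tx) (eg ∘ suc) (λ n → trans (cong (s ∘ suc) (sym (ℕ.+-suc b n))) (es (suc n)))) i }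
  where
  first : x + y ≡ g 0
  first = trans (cong₂ _+_ (at tx zero) (at tq zero)) (sym (eg 0))

divide-Table : ∀ b {m} {xs : Vec ℤ m} {f g} → Quot (suc b) f g → Table xs f → Table (divide b xs) g
divide-Table b {xs = xs} {f} {g} q t = queue-Table (Vec.replicate (suc b) 0ℤ) xs
  (table λ i → trans (lookup-replicate i 0ℤ) (sym (sh-out (suc b) g (toℕ i) (Fin.toℕ<n i))))
  t (step q) (sh-in (suc b) g)

isZero isNonneg : ℤ → Bool
isZero (⁺ zero) = true
isZero _ = false
isNonneg (⁺ _) = true
isNonneg -[1+ _ ] = false

everyFrom : ∀ {m} → ℕ → (ℤ → Bool) → Vec ℤ m → Bool
everyFrom k p [] = true
everyFrom zero p (x ∷ xs) = p x ∧ everyFrom zero p xs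
everyFrom (suc k) p (x ∷ xs) = everyFrom k p xs

everyFrom-sound : ∀ {m} k p (xs : Vec ℤ m) {f} → Table xs f → T (everyFrom k p xs) →
                  ∀ n → k ≤ n → n < m → T (p (f n))
everyFrom-sound zero p (x ∷ xs) t ok zero _ _ = subst (T ∘ p) (at t zero) (proj₁ (Equivalence.to (T-∧ {p x}) ok))
everyFrom-sound zero p (x ∷ xs) t ok (suc n) _ (s≤s lt) =
  everyFrom-sound zero p xs (tail-Table t) (proj₂ (Equivalence.to (T-∧ {p x}) ok)) n z≤n lt
everyFrom-sound (suc k) p (x ∷ xs) t ok (suc n) (s≤s le) (s≤s lt) = everyFrom-sound k p xs (tail-Table t) ok n le lt

-- The numerator 2q³ - 1 - q^(L+3) and its quotients.

op : ℕ → Series → Series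
op L f n = ((sh 3 f n + sh 3 f n) - sh (3 ℕ.+ L) f n) - f n


Quot-op : ∀ L a {f g} → Quot a f g → Quot a (op L f) (op L g)
Quot-op L a q = Quot-- a (Quot-- a (Quot-+ a (Quot-sh a 3 q) (Quot-sh a 3 q)) (Quot-sh a (3 ℕ.+ L) q)) q

-- The parts in the denominator are 3 to k + 2, so k = L + 1 is the case belonging to G_{L,3}.
H : ℕ → ℕ → Series
H L k = op L (N 3 k)

H-Quot : ∀ L k → Quot (3 ℕ.+ k) (H L k) (H L (suc k))
H-Quot L k = Quot-op L (3 ℕ.+ k) (geom-Quot (2 ℕ.+ k) (N 3 k))

-- Substitute N(4, k + 3) = (1 - q³) N(3, k + 3). Keeping k independent of L allows both D = `B L 3`
-- with k = L and the comparison series, whose period is 14 for every k.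
V-Quot : ∀ L k {D} → Quot L (λ n → N 4 k n - δ n) D →
         Quot L (λ n → H L (suc k) n + δ n) (λ n → sh 3 (N 3 (suc k)) n - D n)
V-Quot L k {D} q = quot λ n → begin
  sh 3 X n - D n
    ≡⟨ cong (λ z → sh 3 X n - z) (step q n) ⟩
  sh 3 X n - ((N 4 k n - δ n) + sh L D n)
    ≡⟨ lem (sh 3 X n) (N 4 k n) (δ n) (sh L D n) (sh (3 ℕ.+ L) X n) ⟩
  ((((sh 3 X n + sh 3 X n) - sh (3 ℕ.+ L) X n) - (N 4 k n + sh 3 X n)) + δ n) + (sh (3 ℕ.+ L) X n - sh L D n)
    ≡⟨ cong₂ (λ x y → ((((sh 3 X n + sh 3 X n) - sh (3 ℕ.+ L) X n) - x) + δ n) + (y - sh L D n))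
         (sym (step (N-Quot-lowest 2 k) n)) (trans (cong (λ a → sh a X n) (ℕ.+-comm 3 L)) (sym (sh-sh L 3 X n))) ⟩
  (H L (suc k) n + δ n) + (sh L (sh 3 X) n - sh L D n)
    ≡⟨ cong (λ z → (H L (suc k) n + δ n) + z) (sh-- L (sh 3 X) D n) ⟨
  (H L (suc k) n + δ n) + sh L (λ m → sh 3 X m - D m) n ∎
  where
  open ≡-Reasoning
  X = N 3 (suc k)
  lem : ∀ x q d s y → x - ((q - d) + s) ≡ ((((x + x) - y) - (q + x)) + d) + (y - s)
  lem = solve-∀

G-AB : ∀ L n → G L 3 n ≡ sh 3 (N 3 (suc L)) n - B L 3 n
G-AB L n = cong (λ z → z - B L 3 n) (A-N L 2 n)

-- Nonnegativity for a fixed L.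

-- Past the first b + 1 degrees from n₀ on, g n is f n plus an earlier value g (n - b - 1) of degree
-- at least n₀. Two predicates are used so that f ≥ 0 can also preserve g ≥ 9.
eventually : ∀ (P S : ℤ → Set) → (∀ x y → P x → S y → S (x + y)) →
  ∀ b {f g} n₀ → Quot (suc b) f g → (∀ n → n₀ ≤ n → P (f n)) →
  (∀ n → n₀ ≤ n → n < n₀ ℕ.+ suc b → S (g n)) → ∀ n → n₀ ≤ n → S (g n)
eventually P S close b {f} {g} n₀ q hf hg = <-rec _ go
  where
  go : ∀ n → (∀ {m} → m < n → n₀ ≤ m → S (g m)) → n₀ ≤ n → S (g n)
  go n ih le with n ℕ.<? n₀ ℕ.+ suc b
  ... | yes lt = hg n le lt
  ... | no ¬lt = subst S (sym (step q n)) (close (f n) _ (hf n le)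
      (subst (λ k → S (sh (suc b) g k)) eq (subst S (sym (sh-in (suc b) g m)) (ih m<n le′))))
    where
    m = n ∸ suc b
    ge : n₀ ℕ.+ suc b ≤ n
    ge = ℕ.≮⇒≥ ¬lt
    eq : suc b ℕ.+ m ≡ n
    eq = ℕ.m+[n∸m]≡n (ℕ.≤-trans (ℕ.m≤n+m (suc b) n₀) ge)
    m<n : m < n
    m<n = subst (m <_) eq (s≤s (ℕ.m≤n+m m b))
    le′ : n₀ ≤ m
    le′ = ℕ.m+n≤o⇒m≤o∸n n₀ ge

isZero-sound : ∀ x → T (isZero x) → x ≡ 0ℤ
isZero-sound (⁺ zero) _ = refl

isNonneg-sound : ∀ x → T (isNonneg x) → 0ℤ ≤ℤ x
isNonneg-sound (⁺ n) _ = +≤+ z≤n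

0+0 : ∀ x y → x ≡ 0ℤ → y ≡ 0ℤ → x + y ≡ 0ℤ
0+0 x y refl refl = refl

0≤+ : ∀ x y → 0ℤ ≤ℤ x → 0ℤ ≤ℤ y → 0ℤ ≤ℤ x + y
0≤+ x y = +-mono-≤


sh-vanish : ∀ a {f} c → (∀ n → c ≤ n → f n ≡ 0ℤ) → ∀ n → a ℕ.+ c ≤ n → sh a f n ≡ 0ℤ
sh-vanish zero c v n le = v n le
sh-vanish (suc a) c v (suc n) (s≤s le) = sh-vanish a c v n le

δ-vanish : ∀ n → 1 ≤ n → δ n ≡ 0ℤ
δ-vanish (suc n) _ = refl

H₀-vanish : ∀ L n → 4 ℕ.+ L ≤ n → H L 0 n ≡ 0ℤ
H₀-vanish L n le = cong₂ _-_ (cong₂ _-_ (cong₂ _+_ e e)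
    (sh-vanish (3 ℕ.+ L) 1 δ-vanish n (subst (_≤ n) (ℕ.+-comm 1 (3 ℕ.+ L)) le)))
    (δ-vanish n (ℕ.≤-trans (s≤s z≤n) le))
  where
  e = sh-vanish 3 1 δ-vanish n (ℕ.≤-trans (ℕ.m≤m+n 4 L) le)

diff-vanish : ∀ a {f} c → (∀ n → c ≤ n → f n ≡ 0ℤ) → ∀ n → a ℕ.+ c ≤ n → diff a f n ≡ 0ℤ
diff-vanish a c v n le = cong₂ _-_ (v n (ℕ.≤-trans (ℕ.m≤n+m c a) le)) (sh-vanish a c v n le)

poly : List (ℕ × ℕ) → Series
poly p n = ⁺ (coeff p n)

degree<ᵇ : ℕ → List (ℕ × ℕ) → Bool
degree<ᵇ c = all (λ { (e , _) → e <ᵇ c })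

∧-T : ∀ {a b} → T (a ∧ b) → T a × T b
∧-T {a} = Equivalence.to (T-∧ {a})

poly-vanish : ∀ c p → T (degree<ᵇ c p) → ∀ n → c ≤ n → poly p n ≡ 0ℤ
poly-vanish c [] _ n le = refl
poly-vanish c ((e , a) ∷ p) ok n le with ∧-T {e <ᵇ c} ok | e ≡ᵇ n in eq
... | _ , o | false = poly-vanish c p o n le
... | o , _ | true = contradiction (subst (c ℕ.≤_) (sym (ℕ.≡ᵇ⇒≡ e n (subst T (sym eq) tt))) le) (ℕ.<⇒≱ (ℕ.<ᵇ⇒< e c o))

-- Coefficients below degree m are computed; a sign that holds in the degrees from n₀ to n₀ + v
-- persists under division by 1 - q^a for every a ≤ v + 1.
module Stability (v n₀ m : ℕ) (fits : n₀ ℕ.+ suc v ≤ m) where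

  Sequence : Set
  Sequence = Vec ℤ m

  StableZero StableNonneg : Series → Set
  StableZero f = ∀ n → n₀ ≤ n → f n ≡ 0ℤ
  StableNonneg f = ∀ n → n₀ ≤ n → 0ℤ ≤ℤ f n

  window : ∀ b {n} → b ≤ v → n < n₀ ℕ.+ suc b → n < m
  window b b≤v lt = ℕ.<-≤-trans lt (ℕ.≤-trans (ℕ.+-monoʳ-≤ n₀ (s≤s b≤v)) fits)

  stableZero : ∀ b {f g} (xs : Sequence) → b ≤ v → Quot (suc b) f g → StableZero f →
    Table xs g → T (everyFrom n₀ isZero xs) → StableZero g
  stableZero b xs lt q z t ok = eventually (_≡ 0ℤ) (_≡ 0ℤ) 0+0 b n₀ q z
    (λ n le l → isZero-sound _ (everyFrom-sound n₀ isZero xs t ok n le (window b lt l)))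

  stableNonneg : ∀ b {f g} (xs : Sequence) → b ≤ v → Quot (suc b) f g → StableNonneg f →
    Table xs g → T (everyFrom n₀ isNonneg xs) → StableNonneg g
  stableNonneg b xs lt q z t ok = eventually (0ℤ ≤ℤ_) (0ℤ ≤ℤ_) 0≤+ b n₀ q z
    (λ n le l → isNonneg-sound _ (everyFrom-sound n₀ isNonneg xs t ok n le (window b lt l)))

  Quot-diff-H : ∀ L k → Quot (3 ℕ.+ k) (diff (suc v) (H L k)) (diff (suc v) (H L (suc k)))
  Quot-diff-H L k = Quot-- (3 ℕ.+ k) (H-Quot L k) (Quot-sh (3 ℕ.+ k) (suc v) (H-Quot L k))

  divide34 divide345 : Sequence → Sequence
  divide34 xs = divide 3 (divide 2 xs)
  divide345 xs = divide 4 (divide34 xs)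

  -- For v + 1 = 60 the factors 1 - q³ and 1 - q⁴ cancel: both 1 - q^60 and the numerator vanish at
  -- q = 1, and 1 - q^60 supplies the other roots. The resulting polynomial has value 5(L - 3) at q
  -- = 1, so after division by 1 - q⁵ the coefficients are eventually periodic modulo 5 with mean L
  -- - 3.
  startOK : Sequence → Bool
  startOK z = everyFrom n₀ isZero (divide 2 z) ∧ everyFrom n₀ isZero (divide34 z) ∧ everyFrom n₀ isNonneg (divide345 z)

  record State : Set where
    constructor state
    field ok : Bool
          coeffs : Sequence
  open State

  advance : Bool → Sequence → State
  advance b xs = state (b ∧ everyFrom n₀ isNonneg xs) xs

  next : ℕ → State → State
  next j s = advance (ok s) (divide (5 ℕ.+ j) (coeffs s))

  -- Stage j holds the coefficients for the parts 3 to j + 5; the flag accumulates the sign checks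
  -- of all stages so far.
  run : ℕ → ℕ → State
  run L zero = advance (startOK (prefix (diff (suc v) (H L 0)))) (divide345 (prefix (H L 0)))
  run L (suc j) = next j (run L j)

  run-Table : ∀ L j → Table (coeffs (run L j)) (H L (3 ℕ.+ j))
  run-Table L zero = divide-Table 4 (H-Quot L 2) (divide-Table 3 (H-Quot L 1) (divide-Table 2 (H-Quot L 0) (prefix-Table (H L 0))))
  run-Table L (suc j) = divide-Table (5 ℕ.+ j) (H-Quot L (3 ℕ.+ j)) (run-Table L j)

  -- The first bound puts n₀ beyond the degree of (1 - q^(v+1)) (2q³ - 1 - q^(L+3)); the second
  -- keeps the largest part j + 5 within the window of v + 1 checked coefficients.
  run-stable : ∀ L j → suc v ℕ.+ (4 ℕ.+ L) ≤ n₀ → 4 ℕ.+ j ≤ v → T (ok (run L j)) → StableNonneg (H L (3 ℕ.+ j))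
  run-stable L zero L≤ 4≤v o =
    let z = prefix (diff (suc v) (H L 0))
        (start , nn) = ∧-T {startOK z} o
        (o₁ , o₂₃) = ∧-T {everyFrom n₀ isZero (divide 2 z)} start
        (o₂ , o₃) = ∧-T {everyFrom n₀ isZero (divide34 z)} o₂₃
        t₁ = divide-Table 2 (Quot-diff-H L 0) (prefix-Table (diff (suc v) (H L 0)))
        t₂ = divide-Table 3 (Quot-diff-H L 1) t₁
        t₃ = divide-Table 4 (Quot-diff-H L 2) t₂
        z₀ = λ n le → diff-vanish (suc v) (4 ℕ.+ L) (H₀-vanish L) n (ℕ.≤-trans L≤ le)
        z₁ = stableZero 2 (divide 2 z) (ℕ.≤-trans (ℕ.m≤m+n 2 2) 4≤v) (Quot-diff-H L 0) z₀ t₁ o₁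
        z₂ = stableZero 3 (divide34 z) (ℕ.≤-trans (ℕ.m≤m+n 3 1) 4≤v) (Quot-diff-H L 1) z₁ t₂ o₂
        z₃ = stableNonneg 4 (divide345 z) 4≤v (Quot-diff-H L 2) (λ n le → ≤-reflexive (sym (z₂ n le))) t₃ o₃
    -- Dividing by 1 - q^(v+1) removes the auxiliary factor again.
    in stableNonneg v (coeffs (run L 0)) ℕ.≤-refl (Quot-diff (suc v) (H L 3)) z₃ (run-Table L zero) nn
  run-stable L (suc j) L≤ j≤ o =
    let (o₁ , o₂) = ∧-T {ok (run L j)} o
    in stableNonneg (5 ℕ.+ j) (coeffs (run L (suc j))) (subst (_≤ v) (ℕ.+-suc 4 j) j≤) (H-Quot L (3 ℕ.+ j))
         (run-stable L j L≤ (ℕ.<⇒≤ j≤) o₁) (run-Table L (suc j)) o₂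

  -- What (1 - q^L)(G_{L,3} + p) contains besides `H L (suc L)`.
  correction : ℕ → List (ℕ × ℕ) → Series
  correction L p n = δ n + diff L (poly p) n

  total : ℕ → List (ℕ × ℕ) → Sequence → Sequence
  total j p xs = divide (suc j) (zipWith _+_ xs (prefix (correction (2 ℕ.+ j) p)))

  verdict : ℕ → List (ℕ × ℕ) → State → Bool
  verdict j p s = ok s ∧ everyFrom 0 isNonneg (total j p (coeffs s))

  -- For L = j + 2 the table `run L j` is that of `H L (suc L)`. From n₀ on the correction vanishes,
  -- so one last division, by 1 - q^L, preserves the sign; the degrees below m are read off the
  -- table.
  GPlusNonneg-fixed : ∀ j p → suc v ℕ.+ (6 ℕ.+ j) ≤ n₀ → 4 ℕ.+ j ≤ v → T (degree<ᵇ (suc v) p) →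
    T (verdict j p (run (2 ℕ.+ j) j)) → GPlusNonneg (2 ℕ.+ j) 3 p
  GPlusNonneg-fixed j p L≤ j≤ deg o n = subst (λ z → 0ℤ ≤ℤ z + poly p n) (sym (G-AB L n)) (result n)
    where
    L = 2 ℕ.+ j
    Y F : Series
    Y i = (sh 3 (N 3 (suc L)) i - B L 3 i) + poly p i
    F i = H L (suc L) i + correction L p i
    YQ : Quot L F Y
    YQ = Quot-congˡ (λ i → +-assoc (H L (suc L) i) (δ i) (diff L (poly p) i))
           (Quot-+ L (V-Quot L L (B-Quot L 3)) (Quot-diff L (poly p)))
    t : Table (total j p (coeffs (run L j))) Y
    t = divide-Table (suc j) YQ (zipWith-Table (run-Table L j) (prefix-Table (correction L p)))
    both = ∧-T {ok (run L j)} o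
    L+v≤ : L ℕ.+ suc v ≤ n₀
    L+v≤ = ℕ.≤-trans (ℕ.≤-trans (ℕ.≤-reflexive (ℕ.+-comm L (suc v))) (ℕ.+-monoʳ-≤ (suc v) (ℕ.m≤n+m L 4))) L≤
    c0 : ∀ i → n₀ ≤ i → correction L p i ≡ 0ℤ
    c0 i le = cong₂ _+_ (δ-vanish i (ℕ.≤-trans (s≤s z≤n) (ℕ.≤-trans L≤ le)))
      (diff-vanish L (suc v) (poly-vanish (suc v) p deg) i (ℕ.≤-trans L+v≤ le))
    F0 : StableNonneg F
    F0 i le = subst (0ℤ ≤ℤ_) (sym (trans (cong (λ z → H L (suc L) i + z) (c0 i le)) (+-identityʳ _)))
      (run-stable L j L≤ j≤ (proj₁ both) i le)
    small : ∀ i → i < m → 0ℤ ≤ℤ Y i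
    small i lt = isNonneg-sound _ (everyFrom-sound 0 isNonneg _ t (proj₂ both) i z≤n lt)
    large : StableNonneg Y
    large = eventually (0ℤ ≤ℤ_) (0ℤ ≤ℤ_) 0≤+ (suc j) n₀ YQ F0
      (λ i le lt → small i (window (suc j) (ℕ.≤-trans (ℕ.m≤n+m (suc j) 3) j≤) lt))
    result : ∀ i → 0ℤ ≤ℤ Y i
    result i with i ℕ.<? m
    ... | yes lt = small i lt
    ... | no ¬lt = large i (ℕ.≤-trans (ℕ.m≤m+n n₀ (suc v)) (ℕ.≤-trans fits (ℕ.≮⇒≥ ¬lt)))

-- Monotonicity under shifts and comparison of denominators.

data Split (a : ℕ) : ℕ → Set where
  below : ∀ {n} → n < a → Split a n
  above : ∀ m → Split a (a ℕ.+ m)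

split : ∀ a n → Split a n
split zero n = above n
split (suc a) zero = below (s≤s z≤n)
split (suc a) (suc n) with split a n
... | below lt = below (s≤s lt)
... | above m = above m

Nonneg : Series → Set
Nonneg f = ∀ n → 0ℤ ≤ℤ f n

sh-nonneg : ∀ a {f} → Nonneg f → Nonneg (sh a f)
sh-nonneg zero p n = p n
sh-nonneg (suc a) p zero = ≤-refl
sh-nonneg (suc a) p (suc n) = sh-nonneg a p n

Quot-in : ∀ {a f g} → Quot a f g → ∀ n → g (a ℕ.+ n) ≡ f (a ℕ.+ n) + g n
Quot-in {a} {f} {g} q n = trans (step q (a ℕ.+ n)) (cong (λ z → f (a ℕ.+ n) + z) (sh-in a g n))

Quot-out : ∀ {a f g} → Quot a f g → ∀ n → n < a → g n ≡ f n
Quot-out {a} {f} {g} q n lt = trans (step q n) (trans (cong (λ z → f n + z) (sh-out a g n lt)) (+-identityʳ (f n)))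

geom-nonneg : ∀ b {f} → Nonneg f → Nonneg (geom (suc b) f)
geom-nonneg b {f} p n = eventually (0ℤ ≤ℤ_) (0ℤ ≤ℤ_) 0≤+ b 0 q (λ i _ → p i)
  (λ i _ lt → subst (0ℤ ≤ℤ_) (sym (Quot-out q i lt)) (p i)) n z≤n
  where
  q = geom-Quot b f

x≤y+x : ∀ {x y} → 0ℤ ≤ℤ y → x ≤ℤ y + x
x≤y+x {x} {y} p = subst (_≤ℤ y + x) (+-identityˡ x) (+-monoˡ-≤ x p)

x≤x+y : ∀ {x y} → 0ℤ ≤ℤ y → x ≤ℤ x + y
x≤x+y {x} {y} p = subst (_≤ℤ x + y) (+-identityʳ x) (+-monoʳ-≤ x p)

-- I is a set of shifts along which f is dominated by f′; it passes to the quotients when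
-- the shift may be corrected by the difference of the two periods.
Quot-mono : ∀ (I : ℕ → Set) a b {f f′ g g′} → Quot (suc a) f g → Quot b f′ g′ → Nonneg g′ →
  (∀ i → I i → ∃ λ i′ → I i′ × (i ℕ.+ suc a ≡ b ℕ.+ i′)) →
  (∀ i → I i → ∀ n → f n ≤ℤ f′ (i ℕ.+ n)) → ∀ n i → I i → g n ≤ℤ g′ (i ℕ.+ n)
Quot-mono I a b {f} {f′} {g} {g′} q q′ nn shift ff = <-rec _ go
  where
  go : ∀ n → (∀ {m} → m < n → ∀ i → I i → g m ≤ℤ g′ (i ℕ.+ m)) → ∀ i → I i → g n ≤ℤ g′ (i ℕ.+ n)
  go n ih i Ii with split (suc a) n
  ... | below lt = begin
    g n                      ≡⟨ Quot-out q n lt ⟩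
    f n                      ≤⟨ ff i Ii n ⟩
    f′ (i ℕ.+ n)             ≤⟨ x≤x+y (sh-nonneg b nn (i ℕ.+ n)) ⟩
    f′ (i ℕ.+ n) + sh b g′ (i ℕ.+ n)  ≡⟨ step q′ (i ℕ.+ n) ⟨
    g′ (i ℕ.+ n)             ∎
    where open ≤-Reasoning
  ... | above m with shift i Ii
  ... | i′ , Ii′ , eq = begin
    g (suc a ℕ.+ m)                ≡⟨ Quot-in q m ⟩
    f (suc a ℕ.+ m) + g m          ≤⟨ +-mono-≤ (ff i Ii (suc a ℕ.+ m)) (ih (s≤s (ℕ.m≤n+m m a)) i′ Ii′) ⟩
    f′ (i ℕ.+ (suc a ℕ.+ m)) + g′ (i′ ℕ.+ m)  ≡⟨ cong (λ k → f′ k + g′ (i′ ℕ.+ m)) eq′ ⟩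
    f′ (b ℕ.+ (i′ ℕ.+ m)) + g′ (i′ ℕ.+ m)     ≡⟨ Quot-in q′ (i′ ℕ.+ m) ⟨
    g′ (b ℕ.+ (i′ ℕ.+ m))          ≡⟨ cong g′ eq′ ⟨
    g′ (i ℕ.+ (suc a ℕ.+ m))       ∎
    where
    open ≤-Reasoning
    eq′ : i ℕ.+ (suc a ℕ.+ m) ≡ b ℕ.+ (i′ ℕ.+ m)
    eq′ = trans (sym (ℕ.+-assoc i (suc a) m)) (trans (cong (ℕ._+ m) eq) (ℕ.+-assoc b i′ m))

Mono : ℕ → Series → Set
Mono i f = ∀ n → f n ≤ℤ f (i ℕ.+ n)

N-nonneg : ∀ l k → Nonneg (N (suc l) k)
N-nonneg l k n = subst (0ℤ ≤ℤ_) (count-between l k n) (+≤+ z≤n)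

Mono-geom : ∀ i b {f} → Nonneg f → Mono i f → Mono i (geom (suc b) f)
Mono-geom i b {f} nn mono n = Quot-mono (_≡ i) b (suc b) (geom-Quot b f) (geom-Quot b f) (geom-nonneg b nn)
  (λ { _ refl → i , refl , ℕ.+-comm i (suc b) }) (λ { _ refl → mono }) n i refl

-- Adjoining one part l + j + 1 injects partitions of n into partitions of n + l + j + 1. As series:
-- the identity for this factor gives the base case, and each larger part preserves the inequality.
Mono-N : ∀ l j k → Mono (suc (l ℕ.+ j)) (N (suc l) (k ℕ.+ suc j))
Mono-N l j zero n = subst (N (suc l) (suc j) n ≤ℤ_) (sym (Quot-in (geom-Quot (l ℕ.+ j) (N (suc l) j)) n))
  (x≤y+x (N-nonneg l j _))
Mono-N l j (suc k) = Mono-geom (suc (l ℕ.+ j)) (l ℕ.+ (k ℕ.+ suc j)) (N-nonneg l (k ℕ.+ suc j)) (Mono-N l j k)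

-- Every integer ≥ 4 is a sum of the parts 4, 5, 6, 7.
Mono-N₄ : ∀ k i → Mono (4 ℕ.+ i) (N 4 (k ℕ.+ 4))
Mono-N₄ k 0 = subst (Mono 4 ∘ N 4) (ℕ.+-assoc k 3 1) (Mono-N 3 0 (k ℕ.+ 3))
Mono-N₄ k 1 = subst (Mono 5 ∘ N 4) (ℕ.+-assoc k 2 2) (Mono-N 3 1 (k ℕ.+ 2))
Mono-N₄ k 2 = subst (Mono 6 ∘ N 4) (ℕ.+-assoc k 1 3) (Mono-N 3 2 (k ℕ.+ 1))
Mono-N₄ k 3 = Mono-N 3 3 k
Mono-N₄ k (suc (suc (suc (suc i)))) n = ≤-trans (Mono-N₄ k i n) (Mono-N₄ k 0 (4 ℕ.+ i ℕ.+ n))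

Q : ℕ → Series
Q k n = N 4 (k ℕ.+ 4) n - δ n

Q-nonneg : ∀ k → Nonneg (Q k)
Q-nonneg k n = subst (0ℤ ≤ℤ_) (count-inside 3 (k ℕ.+ 4) n) (+≤+ z≤n)

Q-0 : ∀ k → Q k 0 ≡ 0ℤ
Q-0 k = cong (λ z → z - δ 0) (N-small 0 3 (k ℕ.+ 4) 0 z≤n)

Mono-Q : ∀ k i → Mono (4 ℕ.+ i) (Q k)
Mono-Q k i zero = subst (_≤ℤ Q k (4 ℕ.+ i ℕ.+ 0)) (sym (Q-0 k)) (Q-nonneg k _)
Mono-Q k i (suc n) = +-monoˡ-≤ 0ℤ (Mono-N₄ k i (suc n))

-- Compare q^(iL) f with q^(14i) f for each i: their shifts differ by i(L - 14), which is 0 or at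
-- least 4 because L = k + 18.
B≤geom : ∀ k → ∀ n → B (k ℕ.+ 18) 3 n ≤ℤ geom 14 (λ m → N 4 (k ℕ.+ 18) m - δ m) n
B≤geom k n = Quot-mono I _ 14 (subst (λ c → Quot c f (B (k ℕ.+ 18) 3)) (ℕ.+-comm k 18) (B-Quot (k ℕ.+ 18) 3))
    (geom-Quot 13 f) (geom-nonneg 13 nn) shift mono n 0 (inj₁ refl)
  where
  f = λ m → N 4 (k ℕ.+ 18) m - δ m
  -- The admissible shifts 0, 4, 5, 6, ... are closed under adding L - 14 = k + 4.
  I : ℕ → Set
  I i = (i ≡ 0) ⊎ ∃ λ r → i ≡ 4 ℕ.+ r
  eq : (k ℕ.+ 14) ℕ.+ 4 ≡ k ℕ.+ 18
  eq = ℕ.+-assoc k 14 4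
  nn : Nonneg f
  nn = subst (λ c → Nonneg (λ m → N 4 c m - δ m)) eq (Q-nonneg (k ℕ.+ 14))
  shift : ∀ i → I i → ∃ λ i′ → I i′ × (i ℕ.+ (18 ℕ.+ k) ≡ 14 ℕ.+ i′)
  shift i _ = 4 ℕ.+ (i ℕ.+ k) , inj₂ (i ℕ.+ k , refl) ,
    trans (sym (ℕ.+-assoc i 18 k)) (trans (cong (ℕ._+ k) (ℕ.+-comm i 18)) (ℕ.+-assoc 18 i k))
  mono : ∀ i → I i → ∀ m → f m ≤ℤ f (i ℕ.+ m)
  mono .0 (inj₁ refl) m = ≤-refl
  mono .(4 ℕ.+ r) (inj₂ (r , refl)) = subst (λ c → Mono (4 ℕ.+ r) (λ m → N 4 c m - δ m)) eq (Mono-Q (k ℕ.+ 14) r)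

-- Adding the parts above 17 one at a time.

sumBelow : Series → ℕ → ℤ
sumBelow d zero = 0ℤ
sumBelow d (suc k) = sumBelow d k + d k

sumBelow-nonneg : ∀ {d} → Nonneg d → ∀ k → 0ℤ ≤ℤ sumBelow d k
sumBelow-nonneg nn zero = ≤-refl
sumBelow-nonneg nn (suc k) = 0≤+ _ _ (sumBelow-nonneg nn k) (nn k)

-- Adding a part a lowers coefficient n by at most d (n - a).  For the parts a > k these losses add up
-- to at most sumBelow d (n ∸ k), so a surplus of that size at stage k pays for all of them.
reserve-step : ∀ {d f g} k → Nonneg d → Quot (suc k) f g →
  (∀ n → sumBelow d (n ∸ k) ≤ℤ f n + d n) → ∀ n → sumBelow d (n ∸ suc k) ≤ℤ g n + d n
reserve-step {d} {f} {g} k nn q inv = <-rec _ go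
  where
  go : ∀ n → (∀ {m} → m < n → sumBelow d (m ∸ suc k) ≤ℤ g m + d m) → sumBelow d (n ∸ suc k) ≤ℤ g n + d n
  go n ih with split (suc k) n
  ... | below (s≤s le) rewrite Quot-out q n (s≤s le) | ℕ.m≤n⇒m∸n≡0 (ℕ.m≤n⇒m≤1+n le) =
    subst (λ i → sumBelow d i ≤ℤ f n + d n) (ℕ.m≤n⇒m∸n≡0 le) (inv n)
  ... | above i = begin
    sumBelow d (suc k ℕ.+ i ∸ suc k)   ≡⟨ cong (sumBelow d) (ℕ.m+n∸m≡n (suc k) i) ⟩
    sumBelow d i                       ≤⟨ x≤x+y (≤-trans (sumBelow-nonneg nn (i ∸ suc k)) (ih (s≤s (ℕ.m≤n+m i k)))) ⟩
    sumBelow d i + (g i + d i)         ≡⟨ lem₁ (sumBelow d i) (g i) (d i) ⟩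
    sumBelow d (suc i) + g i           ≡⟨ cong (λ j → sumBelow d j + g i) (trans (cong (_∸ k) (sym (ℕ.+-suc k i))) (ℕ.m+n∸m≡n k (suc i))) ⟨
    sumBelow d (suc k ℕ.+ i ∸ k) + g i ≤⟨ +-monoˡ-≤ (g i) (inv (suc k ℕ.+ i)) ⟩
    (f (suc k ℕ.+ i) + d (suc k ℕ.+ i)) + g i   ≡⟨ lem₂ (f (suc k ℕ.+ i)) (d (suc k ℕ.+ i)) (g i) ⟩
    (f (suc k ℕ.+ i) + g i) + d (suc k ℕ.+ i)   ≡⟨ cong (λ z → z + d (suc k ℕ.+ i)) (Quot-in q i) ⟨
    g (suc k ℕ.+ i) + d (suc k ℕ.+ i)  ∎
    where
    open ≤-Reasoning
    lem₁ : ∀ x y z → x + (y + z) ≡ (x + z) + y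
    lem₁ = solve-∀
    lem₂ : ∀ x y z → (x + y) + z ≡ (x + z) + y
    lem₂ = solve-∀

-- The parts are 3 to k + 17, so passing to k + 1 adjoins the part k + 18.
U : ℕ → Series
U k = geom 14 (H 14 (k ℕ.+ 15))

U-Quot : ∀ k → Quot (suc (17 ℕ.+ k)) (U k) (U (suc k))
U-Quot k = subst (λ c → Quot c (U k) (U (suc k))) (cong (3 ℕ.+_) (ℕ.+-comm k 15))
  (Quot-comm (3 ℕ.+ (k ℕ.+ 15)) 13 (H-Quot 14 (k ℕ.+ 15)) (geom-Quot 13 (H 14 (k ℕ.+ 15))) (geom-Quot 13 (H 14 (suc k ℕ.+ 15))))

errors : List (ℕ × ℕ)
errors = (4 , 1) ∷ (5 , 1) ∷ (8 , 1) ∷ (10 , 1) ∷ (12 , 1) ∷ (14 , 1) ∷ (16 , 1) ∷ []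

-- A polynomial lower bound for the error terms plus 1/(1 - q^14).
debt : Series
debt n = poly errors n + (δ n + sh 14 δ n)

δ-nonneg : Nonneg δ
δ-nonneg zero = +≤+ z≤n
δ-nonneg (suc n) = ≤-refl

debt-nonneg : Nonneg debt
debt-nonneg n = 0≤+ _ _ (+≤+ z≤n) (0≤+ _ _ (δ-nonneg n) (sh-nonneg 14 δ-nonneg n))

debt-vanish : ∀ n → 17 ≤ n → debt n ≡ 0ℤ
debt-vanish n le = cong₂ _+_ (poly-vanish 17 errors tt n le)
  (cong₂ _+_ (δ-vanish n (ℕ.≤-trans (s≤s z≤n) le)) (sh-vanish 14 1 δ-vanish n (ℕ.≤-trans (ℕ.m≤m+n 15 2) le)))

-- Seven error terms together with 1 and q^14, all in degrees below 17.
sumBelow-debt : ∀ k → sumBelow debt (k ℕ.+ 17) ≡ ⁺ 9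
sumBelow-debt zero = refl
sumBelow-debt (suc k) = trans (cong (λ z → sumBelow debt (k ℕ.+ 17) + z) (debt-vanish (k ℕ.+ 17) (ℕ.m≤n+m 17 k)))
  (trans (+-identityʳ _) (sumBelow-debt k))

module ReserveBase (v n₀ m : ℕ) (fits : n₀ ℕ.+ suc v ≤ m) where
  open Stability v n₀ m fits
  open State

  surplus : Series
  surplus n = debt n - sumBelow debt (n ∸ 17)

  largeDegrees smallDegrees : Sequence → Bool
  largeDegrees xs = everyFrom n₀ (λ z → isNonneg (z - ⁺ 9)) xs
  smallDegrees xs = everyFrom 0 isNonneg (zipWith _+_ xs (prefix surplus))

  baseOK : State → Bool
  baseOK s = ok s ∧ (largeDegrees (divide 13 (coeffs s)) ∧ smallDegrees (divide 13 (coeffs s)))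

  module _ (L j : ℕ) where

    W : Series
    W = geom 14 (H L (3 ℕ.+ j))

    xs : Sequence
    xs = divide 13 (coeffs (run L j))

    W-Table : Table xs W
    W-Table = divide-Table 13 (geom-Quot 13 (H L (3 ℕ.+ j))) (run-Table L j)

    base-small : T (smallDegrees xs) → ∀ n → n < m → sumBelow debt (n ∸ 17) ≤ℤ W n + debt n
    base-small o n lt = subst₂ _≤ℤ_ (+-identityˡ _) (lem (W n) (debt n) (sumBelow debt (n ∸ 17)))
      (+-monoˡ-≤ (sumBelow debt (n ∸ 17))
        (isNonneg-sound (W n + surplus n) (everyFrom-sound 0 isNonneg _ (zipWith-Table W-Table (prefix-Table surplus)) o n z≤n lt)))
      where
      lem : ∀ x y z → (x + (y - z)) + z ≡ x + y
      lem = solve-∀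

    -- From degree 34 on the required reserve is the full total 9. Since the dividend is nonnegative
    -- there, 14 consecutive coefficients ≥ 9 force all later ones to be ≥ 9.
    base-large : StableNonneg (H L (3 ℕ.+ j)) → 13 ≤ v → 34 ≤ n₀ → T (largeDegrees xs) →
      ∀ n → n₀ ≤ n → sumBelow debt (n ∸ 17) ≤ℤ W n + debt n
    base-large nn 13≤v 34≤n₀ o n le = begin
      sumBelow debt (n ∸ 17)   ≡⟨ cong (sumBelow debt) (ℕ.m∸n+n≡m 17≤) ⟨
      sumBelow debt (n ∸ 17 ∸ 17 ℕ.+ 17) ≡⟨ sumBelow-debt (n ∸ 17 ∸ 17) ⟩
      ⁺ 9                      ≤⟨ ≥9 n le ⟩
      W n                      ≤⟨ x≤x+y (debt-nonneg n) ⟩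
      W n + debt n             ∎
      where
      open ≤-Reasoning
      17≤ : 17 ≤ n ∸ 17
      17≤ = ℕ.∸-monoˡ-≤ 17 (ℕ.≤-trans 34≤n₀ le)
      ≥9 : ∀ i → n₀ ≤ i → ⁺ 9 ≤ℤ W i
      ≥9 = eventually (0ℤ ≤ℤ_) (⁺ 9 ≤ℤ_) (λ x y p p′ → ≤-trans p′ (x≤y+x p)) 13 n₀ (geom-Quot 13 (H L (3 ℕ.+ j))) nn
        (λ i le lt → 0≤i-j⇒j≤i (isNonneg-sound (W i - ⁺ 9)
          (everyFrom-sound n₀ (λ z → isNonneg (z - ⁺ 9)) xs W-Table o i le (window 13 13≤v lt))))

    base : suc v ℕ.+ (4 ℕ.+ L) ≤ n₀ → 34 ≤ n₀ → 4 ℕ.+ j ≤ v → 13 ≤ v → T (baseOK (run L j)) →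
      ∀ n → sumBelow debt (n ∸ 17) ≤ℤ W n + debt n
    base L≤ 34≤n₀ j≤ 13≤v o n with n ℕ.<? m
    ... | yes lt = base-small (proj₂ (∧-T {largeDegrees xs} (proj₂ (∧-T {ok (run L j)} o)))) n lt
    ... | no ¬lt = base-large (run-stable L j L≤ j≤ (proj₁ (∧-T {ok (run L j)} o))) 13≤v 34≤n₀
        (proj₁ (∧-T {largeDegrees xs} (proj₂ (∧-T {ok (run L j)} o)))) n
        (ℕ.≤-trans (ℕ.m≤m+n n₀ (suc v)) (ℕ.≤-trans fits (ℕ.≮⇒≥ ¬lt)))

reserve : (∀ n → sumBelow debt (n ∸ 17) ≤ℤ U 0 n + debt n) → ∀ k n → sumBelow debt (n ∸ (17 ℕ.+ k)) ≤ℤ U k n + debt n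
reserve base zero = base
reserve base (suc k) n = subst (λ c → sumBelow debt (n ∸ c) ≤ℤ U (suc k) n + debt n) (sym (ℕ.+-suc 17 k))
  (reserve-step (17 ℕ.+ k) debt-nonneg (U-Quot k) (reserve base k) n)

-- For L = k + 18 the parts go up to L + 3 = 17 + (k + 4), which is stage k + 4 of the reserve.
GPlusNonneg-large : (∀ n → sumBelow debt (n ∸ 17) ≤ℤ U 0 n + debt n) → ∀ k → GPlusNonneg (k ℕ.+ 18) 3 errors
GPlusNonneg-large base k n = begin
  0ℤ                                       ≤⟨ sumBelow-nonneg debt-nonneg (n ∸ (17 ℕ.+ (k ℕ.+ 4))) ⟩
  sumBelow debt (n ∸ (17 ℕ.+ (k ℕ.+ 4)))   ≤⟨ reserve base (k ℕ.+ 4) n ⟩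
  U (k ℕ.+ 4) n + debt n                   ≡⟨ lem (U (k ℕ.+ 4) n) (poly errors n) (δ n + sh 14 δ n) ⟩
  -- 1 + q^14 is the beginning of 1/(1 - q^14), which comes from the constant 1 in `V-Quot`.
  (U (k ℕ.+ 4) n + (δ n + sh 14 δ n)) + poly errors n  ≤⟨ +-monoˡ-≤ (poly errors n) (+-monoʳ-≤ (U (k ℕ.+ 4) n) δ≤C) ⟩
  (U (k ℕ.+ 4) n + C n) + poly errors n    ≡⟨ cong (λ z → z + poly errors n) (V≡ n) ⟨
  (sh 3 X n - D n) + poly errors n         ≤⟨ +-monoˡ-≤ (poly errors n) (+-monoʳ-≤ (sh 3 X n) (neg-mono-≤ (B≤geom k n))) ⟩
  (sh 3 X n - B (k ℕ.+ 18) 3 n) + poly errors n ≡⟨ cong (λ z → z + poly errors n) (G-AB (k ℕ.+ 18) n) ⟨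
  G (k ℕ.+ 18) 3 n + poly errors n         ∎
  where
  open ≤-Reasoning
  lem : ∀ x y z → x + (y + z) ≡ (x + z) + y
  lem = solve-∀
  X = N 3 (suc (k ℕ.+ 18))
  D = geom 14 (λ m → N 4 (k ℕ.+ 18) m - δ m)
  C = geom 14 δ
  δ≤C : δ n + sh 14 δ n ≤ℤ C n
  δ≤C = subst (δ n + sh 14 δ n ≤ℤ_) (sym (step (geom-Quot 13 δ) n)) (+-monoʳ-≤ (δ n) (sh-≤ 14 n))
    where
    δ≤ : ∀ m → δ m ≤ℤ C m
    δ≤ m = subst (δ m ≤ℤ_) (sym (step (geom-Quot 13 δ) m)) (x≤x+y (sh-nonneg 14 (geom-nonneg 13 δ-nonneg) m))
    sh-≤ : ∀ a m → sh a δ m ≤ℤ sh a C m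
    sh-≤ zero m = δ≤ m
    sh-≤ (suc a) zero = ≤-refl
    sh-≤ (suc a) (suc m) = sh-≤ a m
  parts≡ : (k ℕ.+ 4) ℕ.+ 15 ≡ suc (k ℕ.+ 18)
  parts≡ = trans (ℕ.+-assoc k 4 15) (ℕ.+-suc k 18)
  V≡ : ∀ m → sh 3 X m - D m ≡ U (k ℕ.+ 4) m + C m
  V≡ = Quot-unique 13 (λ m → cong (λ c → H 14 c m + δ m) (sym parts≡))
    (V-Quot 14 (k ℕ.+ 18) (geom-Quot 13 (λ m → N 4 (k ℕ.+ 18) m - δ m)))
    (Quot-+ 14 (geom-Quot 13 (H 14 ((k ℕ.+ 4) ℕ.+ 15))) (geom-Quot 13 δ))

-- The finite checks and the theorem.

open Stability 59 90 150 ℕ.≤-refl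
-- 59 + 1 = lcm(3, 4, 5). The start 90 lies beyond all polynomial degrees that occur, and 150 = 90 +
-- 60 leaves room for one full window.
open ReserveBase 59 90 150 ℕ.≤-refl

errors₉ errors₈ errors₇ errors₆ errors₅ errors₄ : List (ℕ × ℕ)
errors₉ = (4 , 1) ∷ (5 , 1) ∷ (8 , 1) ∷ (10 , 1) ∷ (12 , 1) ∷ (14 , 1) ∷ (16 , 2) ∷ []
errors₈ = (4 , 1) ∷ (5 , 1) ∷ (8 , 1) ∷ (10 , 1) ∷ (12 , 1) ∷ (14 , 1) ∷ (16 , 2) ∷ (20 , 1) ∷ []
errors₇ = (4 , 1) ∷ (5 , 1) ∷ (8 , 1) ∷ (10 , 1) ∷ (12 , 1) ∷ (14 , 2) ∷ (16 , 1) ∷ (20 , 1) ∷ []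
errors₆ = (4 , 1) ∷ (5 , 1) ∷ (8 , 1) ∷ (10 , 1) ∷ (12 , 1) ∷ (13 , 1) ∷ (14 , 2) ∷ (16 , 2) ∷ (18 , 1) ∷ (20 , 2) ∷ (22 , 1) ∷ []
errors₅ = (4 , 1) ∷ (5 , 1) ∷ (8 , 1) ∷ (10 , 1) ∷ (12 , 2) ∷ (13 , 1) ∷ (14 , 1) ∷ (16 , 2) ∷ (17 , 1) ∷ (18 , 1) ∷ (20 , 3) ∷ (22 , 1) ∷ (24 , 1) ∷ (28 , 1) ∷ []
errors₄ = (4 , 1) ∷ (5 , 1) ∷ (8 , 1) ∷ (10 , 1) ∷ (11 , 1) ∷ (12 , 2) ∷ (14 , 2) ∷ (16 , 3) ∷ (17 , 1) ∷ (18 , 2) ∷ (19 , 1) ∷ (20 , 4) ∷ (22 , 3) ∷ (23 , 1) ∷ (24 , 4) ∷ (25 , 1) ∷ (26 , 4) ∷ (28 , 5) ∷ (29 , 1) ∷ (30 , 3) ∷ (32 , 6) ∷ (34 , 3) ∷ (36 , 4) ∷ (38 , 2) ∷ (40 , 4) ∷ (44 , 2) ∷ []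

reserve-17 : ∀ n → sumBelow debt (n ∸ 17) ≤ℤ U 0 n + debt n
reserve-17 = base 14 12 (ℕ.m≤m+n 78 12) (ℕ.m≤m+n 34 56) (ℕ.m≤m+n 16 43) (ℕ.m≤m+n 13 46) tt

GPlusNonneg-≥10 : ∀ r → GPlusNonneg (r ℕ.+ 10) 3 errors
-- Here j = L - 2, and the inequalities are 66 + j ≤ 90 and 4 + j ≤ 59. The two `tt` are the degree
-- check on the error terms and the evaluated verdict.
GPlusNonneg-≥10 0 = GPlusNonneg-fixed 8 errors (ℕ.m≤m+n 74 16) (ℕ.m≤m+n 12 47) tt tt
GPlusNonneg-≥10 1 = GPlusNonneg-fixed 9 errors (ℕ.m≤m+n 75 15) (ℕ.m≤m+n 13 46) tt tt
GPlusNonneg-≥10 2 = GPlusNonneg-fixed 10 errors (ℕ.m≤m+n 76 14) (ℕ.m≤m+n 14 45) tt tt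
GPlusNonneg-≥10 3 = GPlusNonneg-fixed 11 errors (ℕ.m≤m+n 77 13) (ℕ.m≤m+n 15 44) tt tt
GPlusNonneg-≥10 4 = GPlusNonneg-fixed 12 errors (ℕ.m≤m+n 78 12) (ℕ.m≤m+n 16 43) tt tt
GPlusNonneg-≥10 5 = GPlusNonneg-fixed 13 errors (ℕ.m≤m+n 79 11) (ℕ.m≤m+n 17 42) tt tt
GPlusNonneg-≥10 6 = GPlusNonneg-fixed 14 errors (ℕ.m≤m+n 80 10) (ℕ.m≤m+n 18 41) tt tt
GPlusNonneg-≥10 7 = GPlusNonneg-fixed 15 errors (ℕ.m≤m+n 81 9) (ℕ.m≤m+n 19 40) tt tt
GPlusNonneg-≥10 (suc (suc (suc (suc (suc (suc (suc (suc k)))))))) =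
  subst (λ L → GPlusNonneg L 3 errors) (trans (sym (ℕ.+-assoc k 8 10)) (cong (ℕ._+ 10) (ℕ.+-comm k 8)))
    (GPlusNonneg-large reserve-17 k)

theorem5 : ((L : ℕ) → 10 ≤ L → GPlusNonneg L 3 ((4 , 1) ∷ (5 , 1) ∷ (8 , 1) ∷ (10 , 1) ∷ (12 , 1) ∷ (14 , 1) ∷ (16 , 1) ∷ []))
    × GPlusNonneg 9 3 ((4 , 1) ∷ (5 , 1) ∷ (8 , 1) ∷ (10 , 1) ∷ (12 , 1) ∷ (14 , 1) ∷ (16 , 2) ∷ [])
    × GPlusNonneg 8 3 ((4 , 1) ∷ (5 , 1) ∷ (8 , 1) ∷ (10 , 1) ∷ (12 , 1) ∷ (14 , 1) ∷ (16 , 2) ∷ (20 , 1) ∷ [])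
    × GPlusNonneg 7 3 ((4 , 1) ∷ (5 , 1) ∷ (8 , 1) ∷ (10 , 1) ∷ (12 , 1) ∷ (14 , 2) ∷ (16 , 1) ∷ (20 , 1) ∷ [])
    × GPlusNonneg 6 3 ((4 , 1) ∷ (5 , 1) ∷ (8 , 1) ∷ (10 , 1) ∷ (12 , 1) ∷ (13 , 1) ∷ (14 , 2) ∷ (16 , 2) ∷ (18 , 1) ∷ (20 , 2) ∷ (22 , 1) ∷ [])
    × GPlusNonneg 5 3 ((4 , 1) ∷ (5 , 1) ∷ (8 , 1) ∷ (10 , 1) ∷ (12 , 2) ∷ (13 , 1) ∷ (14 , 1) ∷ (16 , 2) ∷ (17 , 1) ∷ (18 , 1) ∷ (20 , 3) ∷ (22 , 1) ∷ (24 , 1) ∷ (28 , 1) ∷ [])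
    × GPlusNonneg 4 3 ((4 , 1) ∷ (5 , 1) ∷ (8 , 1) ∷ (10 , 1) ∷ (11 , 1) ∷ (12 , 2) ∷ (14 , 2) ∷ (16 , 3) ∷ (17 , 1) ∷ (18 , 2) ∷ (19 , 1) ∷ (20 , 4) ∷ (22 , 3) ∷ (23 , 1) ∷ (24 , 4) ∷ (25 , 1) ∷ (26 , 4) ∷ (28 , 5) ∷ (29 , 1) ∷ (30 , 3) ∷ (32 , 6) ∷ (34 , 3) ∷ (36 , 4) ∷ (38 , 2) ∷ (40 , 4) ∷ (44 , 2) ∷ [])
theorem5 =
    (λ L 10≤L → subst (λ L → GPlusNonneg L 3 errors) (ℕ.m∸n+n≡m 10≤L) (GPlusNonneg-≥10 (L ∸ 10)))
  , GPlusNonneg-fixed 7 errors₉ (ℕ.m≤m+n 73 17) (ℕ.m≤m+n 11 48) tt tt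
  , GPlusNonneg-fixed 6 errors₈ (ℕ.m≤m+n 72 18) (ℕ.m≤m+n 10 49) tt tt
  , GPlusNonneg-fixed 5 errors₇ (ℕ.m≤m+n 71 19) (ℕ.m≤m+n 9 50) tt tt
  , GPlusNonneg-fixed 4 errors₆ (ℕ.m≤m+n 70 20) (ℕ.m≤m+n 8 51) tt tt
  , GPlusNonneg-fixed 3 errors₅ (ℕ.m≤m+n 69 21) (ℕ.m≤m+n 7 52) tt tt
  , GPlusNonneg-fixed 2 errors₄ (ℕ.m≤m+n 68 22) (ℕ.m≤m+n 6 53) tt tt
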